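{- Let $r\geq 1$ and let $G$ be an $r$-regular graph. Then $G$ has a perfect $[1,2]$-factor and thus $o(G)=\mathcal{D}$. Moreover, a winning strategy for Dominator can be computed in polynomial time.
   Context: All graphs are finite and simple. A graph is $r$-regular if all its vertices have degree $r$. A perfect $[1,2]$-factor of a graph $G$ is a spanning subgraph of $G$ (a subgraph with the same vertex set) each of whose connected components is either a single edge $K_2$ or a cycle $C_n$, $n\ge 3$. The Maker-Breaker domination game on a graph $G$: two players, Dominator and Staller, alternately claim a not-yet-claimed vertex of $G$. Dominator wins if at some point the vertices she has claimed form a dominating set of $G$ (a set $S$ with $S\cap N[v]\neq\emptyset$ for every vertex $v$, where $N[v]$ is the closed neighborhood of $v$). Otherwise, i.e. if Staller manages to claim a vertex and all its neighbors, Staller wins. The graph $G$ has outcome $\mathcal{D}$, written $o(G)=\mathcal{D}$, if Dominator has a winning strategy whoever starts (equivalently, if Dominator has a winning strategy when playing second, since no player benefits from skipping a turn). Computing a winning strategy means computing Dominator's winning moves, as second player, in response to the moves of Staller. -}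

module Defs where

open import Data.Bool.Base using (Bool; true; false; T; _∨_)
open import Data.Bool.Properties using (∨-comm)
open import Data.Fin.Base using (Fin; zero; suc; toℕ)
open import Data.Fin.Properties using (toℕ<n)
open import Data.Fin.Subset using (∣_∣)
open import Data.List.Base as List using (List; []; _∷_)
open import Data.List.Membership.Propositional using (_∈_; _∉_)
open import Data.Maybe.Base using (Maybe; just)
open import Data.Nat.Base using (ℕ; zero; suc; _+_; _*_; _^_; _≤_; _<_)
open import Data.Nat.DivMod using (_%_; m<n⇒m%n≡m; n%n≡0)
open import Data.Nat.Properties using (_≟_; m≤n⇒m<n∨m≡n; 1+n≢n)
open import Data.Product.Base using (∃; ∃-syntax; Σ-syntax; _×_; _,_)
open import Data.Sum.Base using (_⊎_; inj₁; inj₂)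
open import Data.Vec.Base as Vec using (Vec; []; _∷_; lookup; tabulate)
open import Function.Bundles using (_⇔_)
open import Function.Definitions using (Injective)
open import Relation.Binary.Construct.Closure.ReflexiveTransitive using (Star)
open import Relation.Binary.PropositionalEquality
  using (_≡_; _≢_; refl; sym; trans; cong₂)
open import Relation.Nullary.Decidable.Core using (does)
open import Relation.Nullary.Decidable using (dec-false)
open import Relation.Unary using (Pred; _≬_)
open import Level using (0ℓ)

------------------------------------------------------------------------
-- Finite simple graphs

record Graph (n : ℕ) : Set where
  field
    adj        : Fin n → Fin n → Bool
    adj-sym    : ∀ u v → adj u v ≡ adj v u
    adj-irrefl : ∀ v → adj v v ≡ false

open Graph public

Adj : ∀ {n} → Graph n → Fin n → Fin n → Set
Adj G u v = T (adj G u v)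

degree : ∀ {n} → Graph n → Fin n → ℕ
degree G v = ∣ tabulate (adj G v) ∣

Regular : ∀ {n} → ℕ → Graph n → Set
Regular r G = ∀ v → degree G v ≡ r

K₂ : Graph 2
K₂ .adj zero       zero       = false
K₂ .adj zero       (suc zero) = true
K₂ .adj (suc zero) zero       = true
K₂ .adj (suc zero) (suc zero) = false
K₂ .adj-sym zero       zero       = refl
K₂ .adj-sym zero       (suc zero) = refl
K₂ .adj-sym (suc zero) zero       = refl
K₂ .adj-sym (suc zero) (suc zero) = refl
K₂ .adj-irrefl zero       = refl
K₂ .adj-irrefl (suc zero) = refl

suc-mod≢ : ∀ m {i} → i < 3 + m → suc i % (3 + m) ≢ i
suc-mod≢ m {i} i<n eq with m≤n⇒m<n∨m≡n i<n
... | inj₁ 1+i<n = 1+n≢n (trans (sym (m<n⇒m%n≡m 1+i<n)) eq)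
... | inj₂ refl with trans (sym (n%n≡0 (3 + m))) eq
...   | ()

-- The cycle on the 3 + m vertices 0, …, 2 + m, with i adjacent to i ± 1
-- modulo 3 + m.
Cycle : ∀ m → Graph (3 + m)
Cycle m .adj i j = does (suc (toℕ i) % (3 + m) ≟ toℕ j)
                 ∨ does (suc (toℕ j) % (3 + m) ≟ toℕ i)
Cycle m .adj-sym i j = ∨-comm (does (suc (toℕ i) % (3 + m) ≟ toℕ j)) _
Cycle m .adj-irrefl i = cong₂ _∨_ i≢1+i i≢1+i
  where
  i≢1+i : does (suc (toℕ i) % (3 + m) ≟ toℕ i) ≡ false
  i≢1+i = dec-false (suc (toℕ i) % (3 + m) ≟ toℕ i) (suc-mod≢ m (toℕ<n i))

------------------------------------------------------------------------
-- Perfect [1,2]-factors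

_⊑_ : ∀ {n} → Graph n → Graph n → Set
H ⊑ G = ∀ {u v} → Adj H u v → Adj G u v

Component : ∀ {n} → Graph n → Fin n → Pred (Fin n) 0ℓ
Component G v u = Star (Adj G) v u

-- The subgraph of G induced on the vertex set C is isomorphic to K.
record InducedIso {n k} (G : Graph n) (C : Pred (Fin n) 0ℓ) (K : Graph k) : Set where
  field
    to        : Fin k → Fin n
    injective : Injective _≡_ _≡_ to
    image     : ∀ u → C u ⇔ (∃[ i ] to i ≡ u)
    preserves : ∀ i j → adj G (to i) (to j) ≡ adj K i j

PerfectFactor[1,2] : ∀ {n} → Graph n → Set
PerfectFactor[1,2] {n} G =
  Σ[ H ∈ Graph n ] (H ⊑ G) ×
    (∀ v → InducedIso H (Component H v) K₂
         ⊎ (∃[ m ] InducedIso H (Component H v) (Cycle m)))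

------------------------------------------------------------------------
-- The Maker-Breaker domination game

N[_,_] : ∀ {n} → Graph n → Fin n → Pred (Fin n) 0ℓ
N[ G , v ] u = u ≡ v ⊎ Adj G v u

Dominating : ∀ {n} → Graph n → Pred (Fin n) 0ℓ → Set
Dominating G S = ∀ v → S ≬ N[ G , v ]

data Player : Set where
  dominator staller : Player

-- The moves made so far, most recent first.
History : ℕ → Set
History n = List (Player × Fin n)

Claimed : ∀ {n} → Player → History n → Pred (Fin n) 0ℓ
Claimed p h v = (p , v) ∈ h

Unclaimed : ∀ {n} → History n → Pred (Fin n) 0ℓ
Unclaimed h v = ∀ p → (p , v) ∉ h

-- A strategy for Dominator.  It need not propose a move in every history
-- (none is possible once all vertices are claimed); `Wins` demands a legal
-- move wherever one is needed.
Strategy : ℕ → Set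
Strategy n = History n → Maybe (Fin n)

-- `Wins G σ p h`: from the history h, with player p to move, Dominator wins
-- every continuation in which she follows σ.  When all vertices are claimed
-- and Dominator does not dominate, no rule applies: Staller has won.
data Wins {n} (G : Graph n) (σ : Strategy n) : Player → History n → Set where
  dominated : ∀ {p h} → Dominating G (Claimed dominator h) → Wins G σ p h
  dominator-moves : ∀ {h v} → σ h ≡ just v → Unclaimed h v →
                    Wins G σ staller ((dominator , v) ∷ h) →
                    Wins G σ dominator h
  staller-moves : ∀ {h} → ∃ (Unclaimed h) →
                  (∀ {v} → Unclaimed h v →
                           Wins G σ dominator ((staller , v) ∷ h)) →
                  Wins G σ staller h

Outcome𝒟 : ∀ {n} → Graph n → Set
Outcome𝒟 G = ∀ first → ∃[ σ ] Wins G σ first []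

------------------------------------------------------------------------
-- Model of computation: a first-order, call-by-value functional language
-- over binary trees, with unit cost per evaluation step (as the language F
-- in Jones, "Computability and Complexity from a Programming Perspective").
-- There is no primitive comparison of whole trees, so every step is a
-- constant-time pointer operation when trees are stored as shared cells;
-- hence for tree-encoded inputs and outputs of polynomial size, polynomial
-- time here agrees with polynomial time on Turing machines.

infixr 5 _∙_

data Tree : Set where
  nil : Tree
  _∙_ : Tree → Tree → Tree

size : Tree → ℕ
size nil     = 1
size (s ∙ t) = 1 + size s + size t

-- Expressions with m variables, over k mutually recursive unary functions.
-- The last branch of `case` binds the left subtree as variable 0 and the
-- right subtree as variable 1.
data Expr (k m : ℕ) : Set where
  var  : Fin m → Expr k m
  nil  : Expr k m
  cons : Expr k m → Expr k m → Expr k m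
  let′ : Expr k m → Expr k (1 + m) → Expr k m
  case : Expr k m → Expr k m → Expr k (2 + m) → Expr k m
  call : Fin k → Expr k m → Expr k m

-- The bodies of the functions; function zero is the entry point.
Program : ℕ → Set
Program k = Vec (Expr (suc k) 1) (suc k)

-- `P , ρ ⊢ e ⇓ t [ c ]`: in the environment ρ, e evaluates to t in c steps.
infix 4 _,_⊢_⇓_[_]

data _,_⊢_⇓_[_] {k} (P : Program k) {m} (ρ : Vec Tree m) :
                Expr (suc k) m → Tree → ℕ → Set where
  var : ∀ {i} → P , ρ ⊢ var i ⇓ lookup ρ i [ 1 ]
  nil : P , ρ ⊢ nil ⇓ nil [ 1 ]
  cons : ∀ {e₁ e₂ t₁ t₂ c₁ c₂} →
         P , ρ ⊢ e₁ ⇓ t₁ [ c₁ ] →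
         P , ρ ⊢ e₂ ⇓ t₂ [ c₂ ] →
         P , ρ ⊢ cons e₁ e₂ ⇓ t₁ ∙ t₂ [ 1 + c₁ + c₂ ]
  let′ : ∀ {e₁ e₂ t₁ t₂ c₁ c₂} →
         P , ρ ⊢ e₁ ⇓ t₁ [ c₁ ] →
         P , t₁ ∷ ρ ⊢ e₂ ⇓ t₂ [ c₂ ] →
         P , ρ ⊢ let′ e₁ e₂ ⇓ t₂ [ 1 + c₁ + c₂ ]
  case-nil : ∀ {e e₁ e₂ t c c₁} →
             P , ρ ⊢ e ⇓ nil [ c ] →
             P , ρ ⊢ e₁ ⇓ t [ c₁ ] →
             P , ρ ⊢ case e e₁ e₂ ⇓ t [ 1 + c + c₁ ]
  case-cons : ∀ {e e₁ e₂ s₁ s₂ t c c₂} →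
              P , ρ ⊢ e ⇓ s₁ ∙ s₂ [ c ] →
              P , s₁ ∷ s₂ ∷ ρ ⊢ e₂ ⇓ t [ c₂ ] →
              P , ρ ⊢ case e e₁ e₂ ⇓ t [ 1 + c + c₂ ]
  call : ∀ {f e s t c c′} →
         P , ρ ⊢ e ⇓ s [ c ] →
         P , s ∷ [] ⊢ lookup P f ⇓ t [ c′ ] →
         P , ρ ⊢ call f e ⇓ t [ 1 + c + c′ ]

-- On the given input, P halts with the given output after at most `bound`
-- steps.
Run_On_Yields_Within_ : ∀ {k} → Program k → Tree → Tree → ℕ → Set
Run P On input Yields output Within bound =
  ∃[ c ] (P , input ∷ [] ⊢ lookup P zero ⇓ output [ c ]) × c ≤ bound

------------------------------------------------------------------------
-- Encodings.  A graph is given by its adjacency matrix.  Vertices are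
-- written in unary, which is harmless next to a matrix with n² entries.

encodeBool : Bool → Tree
encodeBool false = nil
encodeBool true  = nil ∙ nil

encodeℕ : ℕ → Tree
encodeℕ zero    = nil
encodeℕ (suc n) = nil ∙ encodeℕ n

encodeVertex : ∀ {n} → Fin n → Tree
encodeVertex v = encodeℕ (toℕ v)

encodeList : ∀ {A : Set} → (A → Tree) → List A → Tree
encodeList enc []       = nil
encodeList enc (x ∷ xs) = enc x ∙ encodeList enc xs

encodeGraph : ∀ {n} → Graph n → Tree
encodeGraph G = encodeList (λ u → encodeList (λ v → encodeBool (adj G u v)) vertices) vertices
  where vertices = List.allFin _

encodePlayer : Player → Tree
encodePlayer dominator = encodeBool false
encodePlayer staller   = encodeBool true

encodeHistory : ∀ {n} → History n → Tree
encodeHistory = encodeList (λ (p , v) → encodePlayer p ∙ encodeVertex v)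

encodeInput : ∀ {n} → Graph n → History n → Tree
encodeInput G h = encodeGraph G ∙ encodeHistory h

------------------------------------------------------------------------
-- For the graphs of the class 𝒞, a winning strategy for Dominator as second
-- player can be computed in polynomial time: one program, with one
-- polynomial time bound, computes from the graph and the moves made so far
-- the move of a winning strategy.

WinningStrategyInPolynomialTime : (∀ {n} → Graph n → Set) → Set
WinningStrategyInPolynomialTime 𝒞 =
  ∃[ k ] Σ[ P ∈ Program k ] ∃[ a ] ∃[ d ]
    (∀ {n} (G : Graph n) → 𝒞 G →
      Σ[ σ ∈ Strategy n ] Wins G σ staller [] ×
        (∀ h v → σ h ≡ just v →
          Run P On encodeInput G h Yields encodeVertex v
            Within (a * size (encodeInput G h) ^ d + a)))

{-# OPTIONS --safe #-}

-- Let the vertices, as persons, bid for the vertices, as objects: an unassigned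
-- person takes a cheapest neighbour from its owner and raises its price by 1.
-- Regularity (LP duality with the fractional matching 1/r) keeps every price at
-- most n, so after more than n² bids everybody owns a neighbour.  This is a
-- permutation without fixed points along the edges, and its cycles form the
-- factor, a transposition giving a K₂.  With o the owner map and g its inverse,
-- Dominator answers v by the first unclaimed vertex among o v, g v and all the
-- others.
--
-- For the time bound, the program is written in a language whose only loop is
-- a fold limited by a clock of linear length.  At unit cost per step every such
-- program runs in polynomial time, whatever the sizes of its values.

module Submission where

open import Defs
open import Data.Bool.Base as Bool using (Bool; true; false; T; _∨_)
open import Data.Bool.Properties using (∨-comm; T?)
open import Data.Fin.Base as Fin using (Fin; zero; suc; toℕ; fromℕ<; _↑ˡ_; _↑ʳ_; splitAt)
open import Data.Fin.Patterns
open import Data.Fin.Properties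
  using (_≟_; any?; all?; pigeonhole; injective⇒≤; toℕ<n; toℕ-fromℕ<; toℕ-injective; toℕ-inject₁; splitAt-↑ˡ; splitAt-↑ʳ)
  renaming (suc-injective to Fin-suc-injective)
open import Data.Fin.Subset using (∣_∣)
open import Data.List.Base as List using (List; []; _∷_; length; take; allFin)
open import Data.List.Membership.Propositional using (_∈_)
open import Data.List.Membership.Propositional.Properties using (∈-map⁺; ∈-map⁻; ∈-lookup)
open import Data.List.Properties using (length-map; length-tabulate; take-all)
open import Data.List.Relation.Unary.All as All using (All; []; _∷_)
open import Data.List.Relation.Unary.AllPairs using ([]; _∷_)
open import Data.List.Relation.Unary.Any as Any using (Any; here; there)
open import Data.List.Relation.Unary.Unique.Propositional using (Unique)
open import Data.Maybe.Base using (Maybe; just; nothing)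
open import Data.Maybe.Properties using (≡-dec; just-injective)
open import Data.Nat.Base using (ℕ; zero; suc; _+_; _*_; _∸_; _^_; _≤_; _<_; z≤n; s≤s; z<s; >-nonZero)
open import Data.Nat.DivMod using (_%_; m<n⇒m%n≡m; n%n≡0)
open import Data.Nat.GeneralisedArithmetic using () renaming (fold to iterate; fold-+ to iterate-+)
open import Data.Nat.Properties as ℕ hiding (_≟_)
open import Data.Nat.Tactic.RingSolver using (solve-∀)
open import Data.Product.Base using (∃; ∃-syntax; Σ-syntax; _×_; _,_; proj₁; proj₂)
open import Data.Sum.Base using (_⊎_; inj₁; inj₂; [_,_]′)
open import Data.Vec.Base as Vec using (Vec; []; _∷_; lookup)
open import Data.Vec.Properties using (lookup∘tabulate)
open import Algebra.Properties.Semiring.Sum ℕ.+-*-semiring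
  using (sum; sum-syntax; sum-cong-≗; ∑-comm; *-distribˡ-sum; *-distribʳ-sum)
open import Function.Base using (_∘_; id)
open import Function.Bundles using (_⇔_; mk⇔)
open import Function.Definitions using (Injective)
open import Relation.Binary.Construct.Closure.ReflexiveTransitive using (Star; ε; _◅_; _◅◅_)
open import Relation.Binary.Definitions using (tri<; tri≈; tri>)
open import Relation.Binary.PropositionalEquality
open import Relation.Nullary using (¬_; Dec; yes; no; contradiction; does)
open import Relation.Nullary.Decidable using (does-⇔; dec-true; dec-false; decidable-stable; ¬?)
open import Relation.Unary using (Decidable)

-- The [1,2]-factor of a permutation

-- An auction repeats one local step, and the sum of the prices counts these steps; so a blind loop
-- of fixed length computes the matching, with no augmenting paths to search for. An unassigned
-- person leaves a gap when the prices are summed by owners, and this gap is what keeps the next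
-- price at most n.
--
-- The cycles of the permutation may be odd, so it need not pair up the vertices, and Dominator
-- needs two possible answers to a move. The second one works because its vertex cannot be
-- Staller's: otherwise the vertex just played would already have been taken.
--
-- The strategy is not written a second time in Agda. It is extracted from the correctness proof of
-- the program, and all that the game argument knows of it is the relation `Search`. It has to
-- answer arbitrary histories, even ones longer than the clock, which depends on the graph alone.
-- Hence only the latest N moves are inspected; in actual play these are all moves, since claimed
-- vertices are distinct.

least : ∀ {P : ℕ → Set} → Decidable P → ∀ k → P k → ∃[ ℓ ] P ℓ × (∀ {i} → i < ℓ → ¬ P i)
least P? k p with P? 0
... | yes p₀ = 0 , p₀ , λ ()
least P? zero    p | no ¬p₀ = contradiction p ¬p₀
least P? (suc k) p | no ¬p₀ with least (P? ∘ suc) k p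
... | ℓ , q , min = suc ℓ , q , λ { {zero} _ → ¬p₀ ; {suc i} (s≤s i<ℓ) → min i<ℓ }

module Orbits {n} (a : Fin n → Fin n) (a-injective : Injective _≡_ _≡_ a) where

  iterate-injective : ∀ k {u w} → iterate u a k ≡ iterate w a k → u ≡ w
  iterate-injective zero    eq = eq
  iterate-injective (suc k) eq = iterate-injective k (a-injective eq)

  iterate-cancel : ∀ {i j} → i ≤ j → ∀ v → iterate v a i ≡ iterate v a j → iterate v a (j ∸ i) ≡ v
  iterate-cancel {i} {j} i≤j v eq = sym (iterate-injective i (begin
    iterate v a i                  ≡⟨ eq ⟩
    iterate v a j                  ≡⟨ cong (iterate v a) (m+[n∸m]≡n i≤j) ⟨
    iterate v a (i + (j ∸ i))      ≡⟨ iterate-+ v a i ⟩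
    iterate (iterate v a (j ∸ i)) a i ∎))
    where open ≡-Reasoning

  -- Two of the first n + 1 iterates coincide, and injectivity cancels their common part. Minimality
  -- then makes the iterates up to `ℓ` distinct, so that the orbit is a cycle of exactly this
  -- length.
  period : ∀ v → ∃[ ℓ ] iterate v a (suc ℓ) ≡ v × (∀ {i} → i < ℓ → iterate v a (suc i) ≢ v)
  period v with pigeonhole (n<1+n n) (λ i → iterate v a (toℕ i))
  ... | i , j , i<j , eq =
    least (λ k → iterate v a (suc k) ≟ v) (toℕ j ∸ suc (toℕ i))
      (trans (cong (iterate v a) (sym (+-∸-assoc 1 i<j))) (iterate-cancel (<⇒≤ i<j) v eq))

  module Orbit (v : Fin n) {ℓ}
    (returns : iterate v a (suc ℓ) ≡ v) (minimal : ∀ {i} → i < ℓ → iterate v a (suc i) ≢ v) where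

    distinct : ∀ {i j} → i < j → j < suc ℓ → iterate v a i ≢ iterate v a j
    distinct {i} {suc j} i<j (s≤s j<ℓ) eq =
      minimal (≤-trans (s≤s (m∸n≤m j i)) j<ℓ)
        (trans (cong (iterate v a) (sym (+-∸-assoc 1 (≤-pred i<j)))) (iterate-cancel (<⇒≤ i<j) v eq))

    iterate-injective-< : ∀ {i j} → i < suc ℓ → j < suc ℓ → iterate v a i ≡ iterate v a j → i ≡ j
    iterate-injective-< {i} {j} i<L j<L eq with <-cmp i j
    ... | tri< i<j _ _ = contradiction eq (distinct i<j j<L)
    ... | tri≈ _ i≡j _ = i≡j
    ... | tri> _ _ j<i = contradiction (sym eq) (distinct j<i i<L)

    iterate-suc-% : ∀ {i} → i < suc ℓ → suc i % suc ℓ < suc ℓ × iterate v a (suc i) ≡ iterate v a (suc i % suc ℓ)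
    iterate-suc-% {i} i<L with m≤n⇒m<n∨m≡n i<L
    ... | inj₁ 1+i<L = subst (λ r → r < suc ℓ × iterate v a (suc i) ≡ iterate v a r) (sym (m<n⇒m%n≡m 1+i<L)) (1+i<L , refl)
    ... | inj₂ refl  = subst (λ r → r < suc ℓ × iterate v a (suc i) ≡ iterate v a r) (sym (n%n≡0 (suc ℓ))) (z<s , returns)

    step⇔ : ∀ {i j} → i < suc ℓ → j < suc ℓ → a (iterate v a i) ≡ iterate v a j ⇔ suc i % suc ℓ ≡ j
    step⇔ i<L j<L with iterate-suc-% i<L
    ... | r<L , eq = mk⇔ (λ eq′ → iterate-injective-< r<L j<L (trans (sym eq) eq′)) (λ { refl → eq })

    InOrbit : Fin n → Set
    InOrbit u = ∃[ i ] iterate v a (toℕ {suc ℓ} i) ≡ u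

    orbit-forward : ∀ {u} → InOrbit u → InOrbit (a u)
    orbit-forward (i , refl) with iterate-suc-% (toℕ<n i)
    ... | r<L , eq = fromℕ< r<L , trans (cong (iterate v a) (toℕ-fromℕ< r<L)) (sym eq)

    orbit-backward : ∀ {u} → InOrbit (a u) → InOrbit u
    -- The predecessor of `v` itself is the last iterate, number `ℓ`.
    orbit-backward (zero  , eq) = fromℕ< (n<1+n ℓ) ,
      trans (cong (iterate v a) (toℕ-fromℕ< (n<1+n ℓ))) (a-injective (trans returns eq))
    orbit-backward (suc i , eq) = Fin.inject₁ i , trans (cong (iterate v a) (toℕ-inject₁ i)) (a-injective eq)

module _ {n} (G : Graph n) (a : Fin n → Fin n) (a-injective : Injective _≡_ _≡_ a)
  (adj-a : ∀ v → Adj G v (a v)) where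

  open Orbits a a-injective

  a-irrefl : ∀ v → a v ≢ v
  a-irrefl v eq = subst T (trans (cong (adj G v) eq) (adj-irrefl G v)) (adj-a v)

  orbitGraph : Graph n
  orbitGraph .adj u v = does (a u ≟ v) ∨ does (a v ≟ u)
  orbitGraph .adj-sym u v = ∨-comm (does (a u ≟ v)) _
  orbitGraph .adj-irrefl v = cong₂ _∨_ (dec-false (a v ≟ v) (a-irrefl v)) (dec-false (a v ≟ v) (a-irrefl v))

  orbitGraph-adj : ∀ {u v} → Adj orbitGraph u v → a u ≡ v ⊎ a v ≡ u
  orbitGraph-adj {u} {v} e with a u ≟ v | a v ≟ u
  ... | yes eq | _      = inj₁ eq
  ... | no _   | yes eq = inj₂ eq

  orbitGraph-step : ∀ v → Adj orbitGraph v (a v)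
  orbitGraph-step v rewrite dec-true (a v ≟ a v) refl = _

  orbitGraph⊑G : orbitGraph ⊑ G
  orbitGraph⊑G {u} {v} e with orbitGraph-adj e
  ... | inj₁ refl = adj-a u
  ... | inj₂ refl = subst T (adj-sym G v (a v)) (adj-a v)

  star-iterate : ∀ v k → Star (Adj orbitGraph) v (iterate v a k)
  star-iterate v zero    = ε
  star-iterate v (suc k) = star-iterate v k ◅◅ (orbitGraph-step _ ◅ ε)

  -- Along the orbit `a` is the successor modulo `suc ℓ`. Leaving `K` open treats both shapes at
  -- once: the required formula is the definition of `Cycle`, and for two vertices it describes
  -- `K₂`.
  orbit-iso : ∀ v {ℓ} → iterate v a (suc ℓ) ≡ v → (∀ {i} → i < ℓ → iterate v a (suc i) ≢ v) →
              (K : Graph (suc ℓ)) →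
              (∀ i j → does (suc (toℕ i) % suc ℓ ℕ.≟ toℕ j) ∨ does (suc (toℕ j) % suc ℓ ℕ.≟ toℕ i) ≡ adj K i j) →
              InducedIso orbitGraph (Component orbitGraph v) K
  orbit-iso v {ℓ} returns minimal K adj-K = record
    { to        = λ i → iterate v a (toℕ i)
    ; injective = λ eq → toℕ-injective (iterate-injective-< (toℕ<n _) (toℕ<n _) eq)
    ; image     = λ u → mk⇔ (reachable (zero , refl)) λ { (i , refl) → star-iterate v (toℕ i) }
    ; preserves = λ i j → trans
        (cong₂ _∨_ (does-⇔ (step⇔ (toℕ<n i) (toℕ<n j)) (_ ≟ _) (_ ℕ.≟ _))
                   (does-⇔ (step⇔ (toℕ<n j) (toℕ<n i)) (_ ≟ _) (_ ℕ.≟ _)))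
        (adj-K i j)
    }
    where
    open Orbit v returns minimal
    reachable : ∀ {x u} → InOrbit x → Star (Adj orbitGraph) x u → InOrbit u
    reachable o ε = o
    reachable o (e ◅ es) with orbitGraph-adj e
    ... | inj₁ refl = reachable (orbit-forward o) es
    ... | inj₂ refl = reachable (orbit-backward o) es

  perfectFactor : PerfectFactor[1,2] G
  perfectFactor = orbitGraph , orbitGraph⊑G , component
    where
    component : ∀ v → InducedIso orbitGraph (Component orbitGraph v) K₂
                    ⊎ (∃[ m ] InducedIso orbitGraph (Component orbitGraph v) (Cycle m))
    component v with period v
    ... | zero        , returns , minimal = contradiction returns (a-irrefl v)
    ... | suc zero    , returns , minimal = inj₁ (orbit-iso v returns minimal K₂
      λ { zero zero → refl ; zero (suc zero) → refl ; (suc zero) zero → refl ; (suc zero) (suc zero) → refl })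
    ... | suc (suc m) , returns , minimal = inj₂ (m , orbit-iso v returns minimal (Cycle m) (λ _ _ → refl))

-- The game

-- A relation and not a function, because the result is going to be supplied by a run of the
-- program.
data Search {A : Set} (P : A → Set) : List A → Maybe A → Set where
  none  : Search P [] nothing
  here  : ∀ {x xs} → P x → Search P (x ∷ xs) (just x)
  there : ∀ {x xs m} → ¬ P x → Search P xs m → Search P (x ∷ xs) m

search-nothing : ∀ {A : Set} {P : A → Set} {xs} → Search P xs nothing → ∀ {x} → x ∈ xs → ¬ P x
search-nothing (there ¬p s) (here refl)  = ¬p
search-nothing (there ¬p s) (there x∈xs) = search-nothing s x∈xs

search-just : ∀ {A : Set} {P : A → Set} {xs x} → Search P xs (just x) → P x
search-just (here p)    = p
search-just (there _ s) = search-just s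

unique⇒lookup-injective : ∀ {A : Set} {xs : List A} → Unique xs → Injective _≡_ _≡_ (List.lookup xs)
unique⇒lookup-injective (x≢ ∷ u) {zero}  {zero}  eq = refl
unique⇒lookup-injective (x≢ ∷ u) {zero}  {suc j} eq = contradiction eq (All.lookup x≢ (∈-lookup j))
unique⇒lookup-injective (x≢ ∷ u) {suc i} {zero}  eq = contradiction (sym eq) (All.lookup x≢ (∈-lookup i))
unique⇒lookup-injective (x≢ ∷ u) {suc i} {suc j} eq = cong suc (unique⇒lookup-injective u eq)

unique⇒length≤ : ∀ {n} {xs : List (Fin n)} → Unique xs → length xs ≤ n
unique⇒length≤ u = injective⇒≤ (unique⇒lookup-injective u)

Taken : ∀ {n} → History n → Fin n → Set
Taken h v = v ∈ List.map proj₂ h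

taken? : ∀ {n} (h : History n) v → Dec (Taken h v)
taken? h v = Any.any? (v ≟_) (List.map proj₂ h)

taken⁻ : ∀ {n} {h : History n} {v} → Taken h v → Claimed dominator h v ⊎ Claimed staller h v
taken⁻ t with ∈-map⁻ proj₂ t
... | (dominator , _) , c , refl = inj₁ c
... | (staller   , _) , c , refl = inj₂ c

¬taken⇒unclaimed : ∀ {n} {h : History n} {v} → ¬ Taken h v → Unclaimed h v
¬taken⇒unclaimed ¬t p c = ¬t (∈-map⁺ proj₂ c)

unclaimed⇒¬taken : ∀ {n} {h : History n} {v} → Unclaimed h v → ¬ Taken h v
unclaimed⇒¬taken u t with ∈-map⁻ proj₂ t
... | (p , _) , c , refl = u p c

lastVertex : ∀ {n} → Fin n → History n → Fin n
lastVertex v₀ []            = v₀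
lastVertex v₀ ((_ , v) ∷ _) = v

module Pairing {n} (G : Graph n) (f g : Fin n → Fin n)
  (f∘g : ∀ v → f (g v) ≡ v) (adj-f : ∀ v → Adj G v (f v)) (adj-g : ∀ v → Adj G v (g v)) where

  adj⇒≢ : ∀ {u v} → Adj G u v → u ≢ v
  adj⇒≢ {u} a refl rewrite adj-irrefl G u = a

  Dominated : History n → Fin n → Set
  Dominated h v = ∃[ w ] Claimed dominator h w × N[ G , v ] w

  -- Whenever Staller holds u, the vertex f u is taken.  Hence a vertex v that is
  -- still free can only be claimed while g v does not belong to Staller.
  Safe : History n → Set
  Safe h = ∀ v → Claimed staller h v → Taken h (f v) × Dominated h v

  safe-full : ∀ {h} → Safe h → (∀ v → Taken h v) → Dominating G (Claimed dominator h)
  safe-full safe full v with taken⁻ (full v)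
  ... | inj₁ c = v , c , inj₁ refl
  ... | inj₂ c = proj₂ (safe v c)

  -- One round, with `v` the new vertex of Staller. If Dominator holds `f v`, it dominates `v`.
  -- Otherwise `g v` is taken, and not by Staller: safety of `h` at `g v` would make `f (g v)`,
  -- which is `v`, taken before this round.
  safe-next : ∀ {h h′} v → Safe h → ¬ Taken h v →
              (∀ {p u} → (p , u) ∈ h → (p , u) ∈ h′) →
              (∀ {u} → Claimed staller h′ u → u ≡ v ⊎ Claimed staller h u) →
              Taken h′ (f v) → Claimed dominator h′ (f v) ⊎ Taken h′ (g v) → Safe h′
  safe-next {h} {h′} v safe ¬t mono new tf df⊎tg u c with new c
  ... | inj₂ c′ = let t , w , d , w∈N = safe u c′ in
                  [ ∈-map⁺ proj₂ ∘ mono , ∈-map⁺ proj₂ ∘ mono ]′ (taken⁻ t) , w , mono d , w∈N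
  ... | inj₁ refl = tf , v-dominated df⊎tg
    where
    v-dominated : Claimed dominator h′ (f v) ⊎ Taken h′ (g v) → Dominated h′ v
    v-dominated (inj₁ d) = f v , d , inj₂ (adj-f v)
    v-dominated (inj₂ t) with taken⁻ t
    ... | inj₁ d = g v , d , inj₂ (adj-g v)
    ... | inj₂ s with new s
    ...   | inj₁ gv≡v = contradiction (sym gv≡v) (adj⇒≢ (adj-g v))
    ...   | inj₂ s′   = contradiction (subst (Taken h) (f∘g v) (proj₁ (safe (g v) s′))) ¬t

  module _ (v₀ : Fin n) (vs : List (Fin n)) (∈vs : ∀ v → v ∈ vs) (N : ℕ) (n≤N : n ≤ N)
    (σ : Strategy n)
    (σ-first : ∀ h → Search (λ w → ¬ Taken (take N h) w)
                            (f (lastVertex v₀ h) ∷ g (lastVertex v₀ h) ∷ vs) (σ h)) where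

    -- Distinct claimed vertices number at most n ≤ N, so cutting the history at `N` loses nothing.
    σ-first′ : ∀ h → Unique (List.map proj₂ h) → let v = lastVertex v₀ h in
               Search (λ w → ¬ Taken h w) (f v ∷ g v ∷ vs) (σ h)
    σ-first′ h u = subst (λ h′ → Search (λ w → ¬ Taken h′ w) (f (lastVertex v₀ h) ∷ g (lastVertex v₀ h) ∷ vs) (σ h))
      (take-all N h (≤-trans (≤-trans (≤-reflexive (sym (length-map proj₂ h))) (unique⇒length≤ u)) n≤N))
      (σ-first h)

    extend-unique : ∀ (h : History n) {v} → ¬ Taken h v → Unique (List.map proj₂ h) →
                    Unique (v ∷ List.map proj₂ h)
    extend-unique h ¬t u = All.tabulate (λ { t refl → ¬t t }) ∷ u

    -- `k` is fuel for the rounds still possible: at 0 the history would contain more than n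
    -- distinct vertices.
    staller-to-move : ∀ k {h} → n < k + length h → Unique (List.map proj₂ h) → Safe h → Wins G σ staller h
    dominator-to-move : ∀ k {h v} → n < suc k + length h → Unique (List.map proj₂ h) → Safe h → ¬ Taken h v →
                        Unique (List.map proj₂ ((staller , v) ∷ h)) →
                        Wins G σ dominator ((staller , v) ∷ h)

    staller-to-move zero {h} n<l u safe =
      contradiction (≤-trans (≤-reflexive (sym (length-map proj₂ h))) (unique⇒length≤ u)) (<⇒≱ n<l)
    staller-to-move (suc k) {h} n<l u safe with all? (taken? h)
    ... | yes full = dominated (safe-full safe full)
    ... | no ¬full = staller-moves (free (any? (λ v → ¬? (taken? h v))))
      λ {v} unc → dominator-to-move k {h} n<l u safe (unclaimed⇒¬taken unc) (extend-unique h (unclaimed⇒¬taken unc) u)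
      where
      free : Dec (∃ λ v → ¬ Taken h v) → ∃ (Unclaimed h)
      free (yes (v , ¬t)) = v , ¬taken⇒unclaimed ¬t
      free (no ¬∃)        = contradiction (λ v → decidable-stable (taken? h v) (λ ¬t → ¬∃ (v , ¬t))) ¬full

    dominator-to-move k {h} {v} n<l u safe ¬t u′ with σ ((staller , v) ∷ h) in eq | σ-first′ ((staller , v) ∷ h) u′
    -- No candidate is free, so Staller has just claimed the last vertex. Safety extends to this
    -- full board without an answer, as `f v` and `g v` are both taken.
    ... | nothing | s = dominated (safe-full {(staller , v) ∷ h}
      (safe-next v safe ¬t there new (full (f v)) (inj₂ (full (g v)))) full)
      where
      full : ∀ w → Taken ((staller , v) ∷ h) w
      full w = decidable-stable (taken? ((staller , v) ∷ h) w) (search-nothing s (there (there (∈vs w))))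
      new : ∀ {u} → Claimed staller ((staller , v) ∷ h) u → u ≡ v ⊎ Claimed staller h u
      new (here refl) = inj₁ refl
      new (there c)   = inj₂ c
    ... | just w | s = dominator-moves eq (¬taken⇒unclaimed (search-just s))
      (staller-to-move k (≤-trans n<l (≤-trans (≤-reflexive (sym (+-suc k _))) (+-monoʳ-≤ k (n≤1+n _))))
        (extend-unique ((staller , v) ∷ h) (search-just s) u′) (safe′ s))
      where
      h′ = (dominator , w) ∷ (staller , v) ∷ h
      new : ∀ {u} → Claimed staller h′ u → u ≡ v ⊎ Claimed staller h u
      new (there (here refl)) = inj₁ refl
      new (there (there c))   = inj₂ c
      safe′ : Search (λ w → ¬ Taken ((staller , v) ∷ h) w) (f v ∷ g v ∷ vs) (just w) → Safe h′
      safe′ (here _) = safe-next v safe ¬t (λ c → there (there c)) new (here refl) (inj₁ (here refl))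
      safe′ (there tf (here _)) = safe-next v safe ¬t (λ c → there (there c)) new
        (there (decidable-stable (taken? ((staller , v) ∷ h) _) tf)) (inj₂ (here refl))
      safe′ (there tf (there tg _)) = safe-next v safe ¬t (λ c → there (there c)) new
        (there (decidable-stable (taken? ((staller , v) ∷ h) _) tf))
        (inj₂ (there (decidable-stable (taken? ((staller , v) ∷ h) _) tg)))

    σ-wins : ∀ first → Wins G σ first []
    σ-wins staller = staller-to-move (suc n) (≤-reflexive (cong suc (sym (+-identityʳ n)))) [] (λ _ ())
    σ-wins dominator with σ [] in eq | σ-first′ [] []
    ... | nothing | s = contradiction (λ ()) (search-nothing s (here refl))
    -- Any opening move will do, because safety constrains only the vertices of Staller.
    ... | just w  | s = dominator-moves eq (λ _ ())
      (staller-to-move n (≤-reflexive (+-comm 1 n)) ([] ∷ []) (λ { _ (there ()) }))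

-- The auction

sum-mono-≤ : ∀ {n} {f g : Fin n → ℕ} → (∀ i → f i ≤ g i) → sum f ≤ sum g
sum-mono-≤ {zero}  f≤g = z≤n
sum-mono-≤ {suc n} f≤g = +-mono-≤ (f≤g zero) (sum-mono-≤ (f≤g ∘ suc))

term≤sum : ∀ {n} (f : Fin n → ℕ) i → f i ≤ sum f
term≤sum f zero    = m≤m+n _ _
term≤sum f (suc i) = ≤-trans (term≤sum (f ∘ suc) i) (m≤n+m _ _)

-- Where `f` vanishes the slack is all of `g i`. This is the gap that an unassigned person leaves.
sum-mono-gap : ∀ {n} {f g : Fin n → ℕ} → (∀ i → f i ≤ g i) → ∀ i → f i ≡ 0 → sum f + g i ≤ sum g
sum-mono-gap {f = f} {g} f≤g zero eq rewrite eq =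
  ≤-trans (+-monoˡ-≤ (g zero) (sum-mono-≤ (f≤g ∘ suc))) (≤-reflexive (+-comm _ (g zero)))
sum-mono-gap {f = f} {g} f≤g (suc i) eq =
  ≤-trans (≤-reflexive (+-assoc (f zero) _ _)) (+-mono-≤ (f≤g zero) (sum-mono-gap (f≤g ∘ suc) i eq))

sum-mono-< : ∀ {n} {f g : Fin n → ℕ} → (∀ i → f i ≤ g i) → ∀ i → f i < g i → sum f < sum g
sum-mono-< f≤g zero    lt = +-mono-≤ lt (sum-mono-≤ (f≤g ∘ suc))
sum-mono-< f≤g (suc i) lt = +-mono-≤-< (f≤g zero) (sum-mono-< (f≤g ∘ suc) i lt)

sum-zero : ∀ {n} {f : Fin n → ℕ} → (∀ i → f i ≡ 0) → sum f ≡ 0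
sum-zero {zero}  eq = refl
sum-zero {suc n} eq = cong₂ _+_ (eq zero) (sum-zero (eq ∘ suc))

sum-≤-const : ∀ {n} {f : Fin n → ℕ} {b} → (∀ i → f i ≤ b) → sum f ≤ n * b
sum-≤-const {zero}  f≤b = z≤n
sum-≤-const {suc n} f≤b = +-mono-≤ (f≤b zero) (sum-≤-const (f≤b ∘ suc))

sum-suc : ∀ {n} (f : Fin n → ℕ) → ∑[ i < n ] suc (f i) ≡ n + sum f
sum-suc {zero}  f = refl
sum-suc {suc n} f = cong suc (begin
  f zero + ∑[ i < n ] suc (f (suc i)) ≡⟨ cong (f zero +_) (sum-suc (f ∘ suc)) ⟩
  f zero + (n + sum (f ∘ suc))        ≡⟨ +-assoc (f zero) n _ ⟨
  f zero + n + sum (f ∘ suc)          ≡⟨ cong (_+ sum (f ∘ suc)) (+-comm (f zero) n) ⟩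
  n + f zero + sum (f ∘ suc)          ≡⟨ +-assoc n (f zero) _ ⟩
  n + (f zero + sum (f ∘ suc))        ∎)
  where open ≡-Reasoning

𝟙 : Bool → ℕ
𝟙 true  = 1
𝟙 false = 0

∣tabulate∣ : ∀ {n} (f : Fin n → Bool) → ∣ Vec.tabulate f ∣ ≡ ∑[ i < n ] 𝟙 (f i)
∣tabulate∣ {zero}  f = refl
∣tabulate∣ {suc n} f with f zero
... | true  = cong suc (∣tabulate∣ (f ∘ suc))
... | false = ∣tabulate∣ (f ∘ suc)

sum-𝟙≤1 : ∀ {n} (f : Fin n → Bool) → (∀ {i j} → T (f i) → T (f j) → i ≡ j) → ∑[ i < n ] 𝟙 (f i) ≤ 1
sum-𝟙≤1 {zero}  f unique = z≤n
sum-𝟙≤1 {suc n} f unique with f zero in eq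
... | true  = s≤s (≤-reflexive (sum-zero vanish))
  where
  vanish : ∀ i → 𝟙 (f (suc i)) ≡ 0
  vanish i with f (suc i) in eq′
  ... | false = refl
  ... | true  with () ← unique {zero} {suc i} (subst T (sym eq) _) (subst T (sym eq′) _)
... | false = sum-𝟙≤1 (f ∘ suc) λ {i} {j} t u → Fin-suc-injective (unique t u)

-- The bids on each object, latest first: the length of the list is the price
-- of the object and its head is the current owner.
Bids : ℕ → Set
Bids n = Fin n → List (Fin n)

Owns : ∀ {n} → Bids n → Fin n → Fin n → Set
Owns B i j = List.head (B j) ≡ just i

owns? : ∀ {n} (B : Bids n) i j → Dec (Owns B i j)
owns? B i j = ≡-dec _≟_ (List.head (B j)) (just i)

Assigned : ∀ {n} → Bids n → Fin n → Set
Assigned B i = ∃ (Owns B i)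

assigned? : ∀ {n} (B : Bids n) i → Dec (Assigned B i)
assigned? B i = any? (owns? B i)

price : ∀ {n} → Bids n → Fin n → ℕ
price B j = length (B j)

bid : ∀ {n} → Fin n → Fin n → Bids n → Bids n
bid i j B k = Bool.if does (k ≟ j) then i ∷ B k else B k

price-bid : ∀ {n} i j (B : Bids n) → price (bid i j B) j ≡ suc (price B j)
price-bid i j B with j ≟ j
... | yes _ = refl
... | no ¬p = contradiction refl ¬p

price-bid-≥ : ∀ {n} i j (B : Bids n) k → price B k ≤ price (bid i j B) k
price-bid-≥ i j B k with k ≟ j
... | yes _ = n≤1+n _
... | no _  = ≤-refl

owns-bid : ∀ {n i j} {B : Bids n} {x k} → Owns (bid i j B) x k → (x ≡ i × k ≡ j) ⊎ (k ≢ j × Owns B x k)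
owns-bid {j = j} {k = k} o with k ≟ j
... | yes k≡j = inj₁ (sym (just-injective o) , k≡j)
... | no  k≢j = inj₂ (k≢j , o)

price-bid-≢ : ∀ {n i j} (B : Bids n) {k} → k ≢ j → price (bid i j B) k ≡ price B k
price-bid-≢ {j = j} B {k} k≢j with k ≟ j
... | yes k≡j = contradiction k≡j k≢j
... | no _    = refl

module Auction {n r} (G : Graph n) (1≤r : 1 ≤ r) (regular : Regular r G) where

  -- `cheap` is the approximate complementary slackness of auction algorithms, with increment 1: an
  -- object was cheapest for its owner just before the winning bid, and prices never fall.
  record Invariant (B : Bids n) : Set where
    field
      adjacent : ∀ {i j} → Owns B i j → Adj G i j
      unique   : ∀ {i j j′} → Owns B i j → Owns B i j′ → j ≡ j′
      cheap    : ∀ {i j k} → Owns B i j → Adj G i k → price B j ≤ suc (price B k)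
      bounded  : ∀ j → price B j ≤ n

  Cheapest : Bids n → Fin n → Fin n → Set
  Cheapest B i j = Adj G i j × (∀ k → Adj G i k → price B j ≤ price B k)

  e : Fin n → Fin n → ℕ
  e i j = 𝟙 (adj G i j)

  e-sum : ∀ i → ∑[ j < n ] e i j ≡ r
  e-sum i = trans (sym (∣tabulate∣ (adj G i))) (regular i)

  -- Giving each edge the weight 1/r gives each vertex total weight 1; summing the hypothesis over
  -- the weighted edges compares the two sums. Multiplication by `r` and a final cancellation avoid
  -- the fractions.
  edge-sum : ∀ {m p : Fin n → ℕ} → (∀ i j → Adj G i j → m i ≤ p j) → sum m ≤ sum p
  edge-sum {m} {p} m≤p = *-cancelʳ-≤ (sum m) (sum p) r {{>-nonZero 1≤r}} (begin
    sum m * r                           ≡⟨ *-distribʳ-sum r m ⟩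
    ∑[ i < n ] (m i * r)                ≡⟨ sum-cong-≗ (λ i → cong (m i *_) (sym (e-sum i))) ⟩
    ∑[ i < n ] (m i * sum (e i))        ≡⟨ sum-cong-≗ (λ i → *-distribˡ-sum (m i) (e i)) ⟩
    ∑[ i < n ] ∑[ j < n ] (m i * e i j) ≤⟨ sum-mono-≤ (λ i → sum-mono-≤ (edge i)) ⟩
    ∑[ i < n ] ∑[ j < n ] (p j * e j i) ≡⟨ ∑-comm (λ i j → p j * e j i) ⟩
    ∑[ j < n ] ∑[ i < n ] (p j * e j i) ≡⟨ sum-cong-≗ (λ j → *-distribˡ-sum (p j) (e j)) ⟨
    ∑[ j < n ] (p j * sum (e j))        ≡⟨ sum-cong-≗ (λ j → cong (p j *_) (e-sum j)) ⟩
    ∑[ j < n ] (p j * r)                ≡⟨ *-distribʳ-sum r p ⟨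
    sum p * r                           ∎)
    where
    open ≤-Reasoning
    edge : ∀ i j → m i * e i j ≤ p j * e j i
    edge i j rewrite adj-sym G j i with adj G i j in eq
    ... | true  = *-monoˡ-≤ 1 (m≤p i j (subst T (sym eq) _))
    ... | false = ≤-reflexive (trans (*-zeroʳ (m i)) (sym (*-zeroʳ (p j))))

  module _ {B : Bids n} (inv : Invariant B) where
    open Invariant inv

    private
      p = price B

      c : Fin n → Fin n → ℕ
      c i j = 𝟙 (does (owns? B i j))

    owned-sum≤1 : ∀ i → ∑[ j < n ] c i j ≤ 1
    owned-sum≤1 i = sum-𝟙≤1 _ (λ {j} {k} → same j k)
      where
      same : ∀ j k → T (does (owns? B i j)) → T (does (owns? B i k)) → j ≡ k
      same j k t u with owns? B i j | owns? B i k
      ... | yes o | yes o′ = unique o o′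

    -- An object of positive price has an owner, so the prices can be regrouped by owners. Each
    -- person occurs at most once and `i₀` not at all, which leaves room for the extra term
    -- `suc (m i₀)`.
    price-sum : (m : Fin n → ℕ) → (∀ {i j} → Owns B i j → p j ≤ suc (m i)) →
                ∀ {i₀} → ¬ Assigned B i₀ → sum p + suc (m i₀) ≤ n + sum m
    price-sum m p≤m {i₀} ¬a = begin
      sum p + suc (m i₀)                               ≤⟨ +-monoˡ-≤ (suc (m i₀)) (sum-mono-≤ by-owner) ⟩
      ∑[ j < n ] ∑[ i < n ] (c i j * suc (m i)) + suc (m i₀)
        ≡⟨ cong (_+ suc (m i₀)) (∑-comm (λ j i → c i j * suc (m i))) ⟩
      ∑[ i < n ] ∑[ j < n ] (c i j * suc (m i)) + suc (m i₀)
        ≡⟨ cong (_+ suc (m i₀)) (sum-cong-≗ (λ i → *-distribʳ-sum (suc (m i)) (c i))) ⟨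
      ∑[ i < n ] (sum (c i) * suc (m i)) + suc (m i₀)    ≤⟨ sum-mono-gap at-most-once i₀ unowned ⟩
      ∑[ i < n ] suc (m i)                             ≡⟨ sum-suc m ⟩
      n + sum m                                        ∎
      where
      open ≤-Reasoning
      by-owner : ∀ j → p j ≤ ∑[ i < n ] (c i j * suc (m i))
      by-owner j = go (B j) refl
        where
        term : ∀ i → Owns B i j → p j ≤ c i j * suc (m i)
        term i o with owns? B i j
        ... | yes _ = ≤-trans (p≤m o) (m≤m+n _ 0)
        ... | no ¬o = contradiction o ¬o
        go : ∀ b → B j ≡ b → p j ≤ ∑[ i < n ] (c i j * suc (m i))
        go []      eq = ≤-trans (≤-reflexive (cong length eq)) z≤n
        go (i ∷ _) eq = ≤-trans (term i (cong List.head eq)) (term≤sum (λ i → c i j * suc (m i)) i)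
      at-most-once : ∀ i → sum (c i) * suc (m i) ≤ suc (m i)
      at-most-once i = ≤-trans (*-monoˡ-≤ (suc (m i)) (owned-sum≤1 i)) (≤-reflexive (*-identityˡ _))
      vanish : ∀ j → c i₀ j ≡ 0
      vanish j with owns? B i₀ j
      ... | yes o = contradiction (j , o) ¬a
      ... | no _  = refl
      unowned : sum (c i₀) * suc (m i₀) ≡ 0
      unowned = cong (_* suc (m i₀)) (sum-zero vanish)

    -- LP duality: m i is a lower bound on the prices of the neighbours of i
    -- that is attained up to 1 by the object which i owns.  By regularity
    -- the m i add up to at most the sum of all prices.
    cheapest<n : ∀ {i₀ j₀} → ¬ Assigned B i₀ → Cheapest B i₀ j₀ → p j₀ < n
    cheapest<n {i₀} {j₀} ¬a (_ , p≤) = +-cancelˡ-≤ (sum p) _ _ (begin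
      sum p + suc (p j₀)  ≤⟨ +-monoʳ-≤ (sum p) (s≤s m-i₀) ⟩
      sum p + suc (m i₀)  ≤⟨ price-sum m m-owned ¬a ⟩
      n + sum m           ≤⟨ +-monoʳ-≤ n (edge-sum m-edge) ⟩
      n + sum p           ≡⟨ +-comm n (sum p) ⟩
      sum p + n           ∎)
      where
      open ≤-Reasoning
      m : Fin n → ℕ
      -- An owner falls short of the price paid by 1, the tolerance in `cheap`; `i₀` gets its
      -- cheapest price in full. For the other unassigned persons the trivial lower bound 0 is
      -- enough.
      m i with assigned? B i | i ≟ i₀
      ... | yes (j , _) | _     = p j ∸ 1
      ... | no _        | yes _ = p j₀
      ... | no _        | no _  = 0
      m-edge : ∀ i k → Adj G i k → m i ≤ p k
      m-edge i k ik with assigned? B i | i ≟ i₀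
      ... | yes (j , o) | _        = m≤n+o⇒m∸n≤o (p j) 1 (cheap o ik)
      ... | no _        | yes refl = p≤ k ik
      ... | no _        | no _     = z≤n
      m-owned : ∀ {i j} → Owns B i j → p j ≤ suc (m i)
      m-owned {i} {j} o with assigned? B i | i ≟ i₀
      ... | no ¬a        | _ = contradiction (j , o) ¬a
      ... | yes (j′ , o′) | _ with refl ← unique o o′ = m≤n+m∸n (p j) 1
      m-i₀ : p j₀ ≤ m i₀
      m-i₀ with assigned? B i₀ | i₀ ≟ i₀
      ... | yes a | _     = contradiction a ¬a
      ... | no _  | yes _ = ≤-refl
      ... | no _  | no ¬e = contradiction refl ¬e

    -- The object was cheapest, so after the raise it exceeds no alternative by more than 1. For the
    -- other owners only alternatives have become dearer. The bound on the raised price is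
    -- `cheapest<n`.
    bid-invariant : ∀ {i j} → ¬ Assigned B i → Cheapest B i j → Invariant (bid i j B)
    bid-invariant {i} {j} ¬a cheapest@(ij , p≤) = record
      { adjacent = adjacent′ ; unique = unique′ ; cheap = cheap′ ; bounded = bounded′ }
      where
      adjacent′ : ∀ {x k} → Owns (bid i j B) x k → Adj G x k
      adjacent′ o with owns-bid {B = B} o
      ... | inj₁ (refl , refl) = ij
      ... | inj₂ (_ , o′)      = adjacent o′
      unique′ : ∀ {x k k′} → Owns (bid i j B) x k → Owns (bid i j B) x k′ → k ≡ k′
      unique′ o₁ o₂ with owns-bid {B = B} o₁ | owns-bid {B = B} o₂
      ... | inj₁ (_ , refl) | inj₁ (_ , refl) = refl
      ... | inj₁ (refl , _) | inj₂ (_ , o)    = contradiction (_ , o) ¬a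
      ... | inj₂ (_ , o)    | inj₁ (refl , _) = contradiction (_ , o) ¬a
      ... | inj₂ (_ , o)    | inj₂ (_ , o′)   = unique o o′
      cheap′ : ∀ {x k l} → Owns (bid i j B) x k → Adj G x l → price (bid i j B) k ≤ suc (price (bid i j B) l)
      cheap′ {l = l} o xl with owns-bid {B = B} o
      ... | inj₁ (refl , refl) rewrite price-bid i j B = s≤s (≤-trans (p≤ l xl) (price-bid-≥ i j B l))
      ... | inj₂ (k≢j , o′) rewrite price-bid-≢ {i = i} B k≢j = ≤-trans (cheap o′ xl) (s≤s (price-bid-≥ i j B l))
      bounded′ : ∀ k → price (bid i j B) k ≤ n
      bounded′ k with k ≟ j
      ... | yes refl = cheapest<n ¬a cheapest
      ... | no _     = bounded k

    sum-price-≤ : sum p ≤ n * n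
    sum-price-≤ = sum-≤-const bounded

  sum-price-bid : ∀ i j (B : Bids n) → sum (price B) < sum (price (bid i j B))
  sum-price-bid i j B = sum-mono-< (price-bid-≥ i j B) j (≤-reflexive (sym (price-bid i j B)))

  neighbour : ∀ i → ∃ (Adj G i)
  neighbour i with any? (λ j → T? (adj G i j))
  ... | yes nb = nb
  ... | no ¬nb = contradiction (trans (sym (e-sum i)) (sum-zero vanish)) (>⇒≢ 1≤r)
    where
    vanish : ∀ j → e i j ≡ 0
    vanish j with adj G i j in eq
    ... | false = refl
    ... | true  = contradiction (j , subst T (sym eq) _) ¬nb

  -- Infinite descent on the price of a neighbour. The double negation is all that is wanted, since
  -- it only has to refute a failed search.
  ¬¬cheapest : ∀ B i → ¬ (∀ j → ¬ Cheapest B i j)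
  ¬¬cheapest B i ¬c = let j , ij = neighbour i in go (price B j) ij ≤-refl
    where
    go : ∀ b {j} → Adj G i j → ¬ price B j ≤ b
    go b {j} ij pj≤b = ¬c j (ij , λ k ik → ≮⇒≥ (cheaper b pj≤b ik))
      where
      cheaper : ∀ b → price B j ≤ b → ∀ {k} → Adj G i k → ¬ price B k < price B j
      cheaper zero    pj≤b ik pk<pj = contradiction (≤-trans pk<pj pj≤b) λ ()
      cheaper (suc b) pj≤b ik pk<pj = go b ik (≤-pred (≤-trans pk<pj pj≤b))

  module Matching {B : Bids n} (inv : Invariant B) (assigned : ∀ i → Assigned B i) where
    open Invariant inv

    object : Fin n → Fin n
    object i = proj₁ (assigned i)

    owns-object : ∀ i → Owns B i (object i)
    owns-object i = proj₂ (assigned i)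

    object-injective : Injective _≡_ _≡_ object
    object-injective {i} {j} eq = just-injective
      (trans (sym (owns-object i)) (trans (cong (List.head ∘ B) eq) (owns-object j)))

    open Orbits object object-injective using (period)

    -- The inverse of a permutation of a finite set: stop one step before the orbit closes. This
    -- also shows that every object has been bid for.
    owner : Fin n → Fin n
    owner j = iterate j object (proj₁ (period j))

    object-owner : ∀ j → object (owner j) ≡ j
    object-owner j = proj₁ (proj₂ (period j))

    owner-object : ∀ i → owner (object i) ≡ i
    owner-object i = object-injective (object-owner (object i))

    owns-owner : ∀ j → Owns B (owner j) j
    owns-owner j = subst (Owns B (owner j)) (object-owner j) (owns-object (owner j))

    adj-object : ∀ i → Adj G i (object i)
    adj-object i = adjacent (owns-object i)

    adj-owner : ∀ j → Adj G j (owner j)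
    adj-owner j = subst T (adj-sym G (owner j) j) (adjacent (owns-owner j))

-- A language with clocked folds, and its compilation

data Code (m : ℕ) : Set where
  var   : Fin m → Code m
  nil   : Code m
  cons  : Code m → Code m → Code m
  hd tl : Code m → Code m
  if    : Code m → Code m → Code m → Code m
  let′  : Code m → Code (1 + m) → Code m
  fold  : Code m → Code m → Code (2 + m) → Code m

head tail : Tree → Tree
head nil     = nil
head (s ∙ t) = s
tail nil     = nil
tail (s ∙ t) = t

infix 0 if_then_else_
if_then_else_ : Tree → Tree → Tree → Tree
if nil     then t else u = u
if (_ ∙ _) then t else u = t

-- Only the first `N` entries are seen. Nested folds do not share the clock; each starts with the
-- full one, so the nesting depth shows up in the degree of the time bound.
foldTree : ℕ → (Tree → Tree → Tree) → Tree → Tree → Tree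
foldTree zero    f z _       = z
foldTree (suc N) f z nil     = z
foldTree (suc N) f z (s ∙ t) = f s (foldTree N f z t)

⟦_⟧ : ∀ {m} → Code m → ℕ → Vec Tree m → Tree
⟦ var i ⟧      N ρ = lookup ρ i
⟦ nil ⟧        N ρ = nil
⟦ cons c d ⟧   N ρ = ⟦ c ⟧ N ρ ∙ ⟦ d ⟧ N ρ
⟦ hd c ⟧       N ρ = head (⟦ c ⟧ N ρ)
⟦ tl c ⟧       N ρ = tail (⟦ c ⟧ N ρ)
⟦ if c d e ⟧   N ρ = if ⟦ c ⟧ N ρ then ⟦ d ⟧ N ρ else ⟦ e ⟧ N ρ
⟦ let′ c d ⟧   N ρ = ⟦ d ⟧ N (⟦ c ⟧ N ρ ∷ ρ)
⟦ fold c d e ⟧ N ρ = foldTree N (λ x acc → ⟦ e ⟧ N (x ∷ acc ∷ ρ)) (⟦ d ⟧ N ρ) (⟦ c ⟧ N ρ)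

spine : Tree → ℕ
spine nil     = 0
spine (s ∙ t) = suc (spine t)

-- A compiled piece of code finds its environment, followed by the clock that
-- limits the folds, as a list in variable 0.
pack : ∀ {m} → Vec Tree m → Tree → Tree
pack []      k = k
pack (t ∷ ρ) k = t ∙ pack ρ k

-- The target language has only global functions, so each fold becomes one of them; the maps `ι`
-- below say which.
folds : ∀ {m} → Code m → ℕ
folds (var i)      = 0
folds nil          = 0
folds (cons c d)   = folds c + folds d
folds (hd c)       = folds c
folds (tl c)       = folds c
folds (if c d e)   = folds c + (folds d + folds e)
folds (let′ c d)   = folds c + folds d
folds (fold c d e) = suc (folds c + (folds d + folds e))

module _ {K : ℕ} where

  tailExpr : ∀ {j} → ℕ → Expr K (suc j) → Expr K (suc j)
  tailExpr zero    e = e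
  tailExpr (suc i) e = case (tailExpr i e) nil (var 1F)

  compile : ∀ {m} (c : Code m) → (Fin (folds c) → Fin K) → ∀ {j} → Expr K (suc j)
  compile (var i)    ι = case (tailExpr (toℕ i) (var 0F)) nil (var 0F)
  compile nil        ι = nil
  compile (cons c d) ι = cons (compile c (ι ∘ (_↑ˡ folds d))) (compile d (ι ∘ (folds c ↑ʳ_)))
  compile (hd c)     ι = case (compile c ι) nil (var 0F)
  compile (tl c)     ι = case (compile c ι) nil (var 1F)
  compile (if c d e) ι =
    case (compile c (ι ∘ (_↑ˡ (folds d + folds e))))
         (compile e (ι ∘ (folds c ↑ʳ_) ∘ (folds d ↑ʳ_)))
         -- The branch for a nonempty tree binds two subtrees; the packed environment has moved to
         -- variable 2 and is brought back to variable 0.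
         (let′ (var 2F) (compile d (ι ∘ (folds c ↑ʳ_) ∘ (_↑ˡ folds e))))
  compile (let′ c d) ι =
    let′ (cons (compile c (ι ∘ (_↑ˡ folds d))) (var 0F)) (compile d (ι ∘ (folds c ↑ʳ_)))
  compile {m} (fold c d e) ι =
    -- Dropping the `m` values from the packed environment leaves the clock.
    call (ι 0F) (cons (cons (tailExpr m (var 0F)) (compile c (ι ∘ suc ∘ (_↑ˡ (folds d + folds e)))))
                      (cons (compile d (ι ∘ suc ∘ (folds c ↑ʳ_) ∘ (_↑ˡ folds e))) (var 0F)))

  -- The argument is (clock ∙ list) ∙ (initial value ∙ environment).
  foldBody : Fin K → (∀ {j} → Expr K (suc j)) → Expr K 1
  foldBody self e =
    case (var 0F) nil
      (case (var 0F) nil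
        (case (var 0F) (case (var 3F) nil (var 0F))
          (case (var 3F) (case (var 5F) nil (var 0F))
            -- Variable 0 is the current entry, 1 the rest of the list, 3 the shortened clock and 7
            -- the initial value with the environment. The result of the call shifts all of these by
            -- one.
            (let′ (call self (cons (cons (var 3F) (var 1F)) (var 7F)))
              (case (var 8F) nil
                (let′ (cons (var 3F) (cons (var 2F) (var 1F))) e))))))

  bodies : ∀ {m} (c : Code m) → (Fin (folds c) → Fin K) → Fin (folds c) → Expr K 1
  bodies (cons c d)   ι i = [ bodies c (ι ∘ (_↑ˡ folds d)) , bodies d (ι ∘ (folds c ↑ʳ_)) ]′ (splitAt (folds c) i)
  bodies (hd c)       ι i = bodies c ι i
  bodies (tl c)       ι i = bodies c ι i
  bodies (if c d e)   ι i =
    [ bodies c (ι ∘ (_↑ˡ (folds d + folds e)))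
    , (λ j → [ bodies d (ι ∘ (folds c ↑ʳ_) ∘ (_↑ˡ folds e))
             , bodies e (ι ∘ (folds c ↑ʳ_) ∘ (folds d ↑ʳ_)) ]′ (splitAt (folds d) j))
    ]′ (splitAt (folds c) i)
  bodies (let′ c d)   ι i = [ bodies c (ι ∘ (_↑ˡ folds d)) , bodies d (ι ∘ (folds c ↑ʳ_)) ]′ (splitAt (folds c) i)
  bodies (fold c d e) ι zero    = foldBody (ι 0F) (compile e (ι ∘ suc ∘ (folds c ↑ʳ_) ∘ (folds d ↑ʳ_)))
  bodies (fold c d e) ι (suc i) =
    [ bodies c (ι ∘ suc ∘ (_↑ˡ (folds d + folds e)))
    , (λ j → [ bodies d (ι ∘ suc ∘ (folds c ↑ʳ_) ∘ (_↑ˡ folds e))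
             , bodies e (ι ∘ suc ∘ (folds c ↑ʳ_) ∘ (folds d ↑ʳ_)) ]′ (splitAt (folds d) j))
    ]′ (splitAt (folds c) i)

-- Cost and correctness of the compilation

tailCost : ℕ → ℕ
tailCost zero    = 1
tailCost (suc i) = 2 + tailCost i

-- 10 leaves room for the exit on an exhausted clock; 23 pays for a full round of `foldBody` apart
-- from the recursive call and the body, of cost `b`.
foldCost : ℕ → ℕ → ℕ
foldCost b zero    = 10
foldCost b (suc N) = 23 + (foldCost b N + b)

-- A function of the clock alone, independent of all values: both branches of `if` are charged, and
-- each fold is charged for its maximal number of rounds.
cost : ∀ {m} → Code m → ℕ → ℕ
cost (var i)          N = 2 + tailCost (toℕ i)
cost nil              N = 1
cost (cons c d)       N = 1 + (cost c N + cost d N)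
cost (hd c)           N = 2 + cost c N
cost (tl c)           N = 2 + cost c N
cost (if c d e)       N = 3 + (cost c N + (cost d N + cost e N))
cost (let′ c d)       N = 3 + (cost c N + cost d N)
cost {m} (fold c d e) N = 5 + (tailCost m + (cost c N + (cost d N + foldCost (cost e N) N)))

tails : ℕ → Tree → Tree
tails zero    t = t
tails (suc i) t = tail (tails i t)

tails-tail : ∀ i t → tails i (tail t) ≡ tail (tails i t)
tails-tail zero    t = refl
tails-tail (suc i) t = cong tail (tails-tail i t)

head-tails : ∀ {m} (i : Fin m) (ρ : Vec Tree m) κ → head (tails (toℕ i) (pack ρ κ)) ≡ lookup ρ i
head-tails zero    (t ∷ ρ) κ = refl
head-tails (suc i) (t ∷ ρ) κ = trans (cong head (sym (tails-tail (toℕ i) _))) (head-tails i ρ κ)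

tails-pack : ∀ {m} (ρ : Vec Tree m) κ → tails m (pack ρ κ) ≡ κ
tails-pack []              κ = refl
tails-pack {suc m} (t ∷ ρ) κ = trans (sym (tails-tail m _)) (tails-pack ρ κ)

linkedˡ : ∀ {a b} {A : Set} {f : Fin (a + b) → A} {g : Fin a → A} {h : Fin b → A} →
          (∀ i → f i ≡ [ g , h ]′ (splitAt a i)) → ∀ i → f (i ↑ˡ b) ≡ g i
linkedˡ {a} {b} eq i = trans (eq _) (cong [ _ , _ ]′ (splitAt-↑ˡ a i b))

linkedʳ : ∀ {a b} {A : Set} {f : Fin (a + b) → A} {g : Fin a → A} {h : Fin b → A} →
          (∀ i → f i ≡ [ g , h ]′ (splitAt a i)) → ∀ i → f (a ↑ʳ i) ≡ h i
linkedʳ {a} {b} eq i = trans (eq _) (cong [ _ , _ ]′ (splitAt-↑ʳ a b i))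

fold-arith : ∀ f b → 9 + (6 + f + (8 + b)) ≡ 23 + (f + b)
fold-arith = solve-∀

if-arith : ∀ c d → 1 + (c + (2 + d)) ≡ 3 + (c + d)
if-arith = solve-∀

let-arith : ∀ c d → 2 + (c + 1) + d ≡ 3 + (c + d)
let-arith = solve-∀

call-arith : ∀ t c d f → 2 + (1 + (t + c) + (1 + (d + 1)) + f) ≡ 5 + (t + (c + (d + f)))
call-arith = solve-∀

module _ {k} (P : Program k) where

  infix 4 _⊢_⇓_[≤_]
  _⊢_⇓_[≤_] : ∀ {m} → Vec Tree m → Expr (suc k) m → Tree → ℕ → Set
  ρ ⊢ e ⇓ t [≤ b ] = ∃[ c ] (P , ρ ⊢ e ⇓ t [ c ]) × c ≤ b

  weaken : ∀ {m} {ρ : Vec Tree m} {e t b b′} → b ≤ b′ → ρ ⊢ e ⇓ t [≤ b ] → ρ ⊢ e ⇓ t [≤ b′ ]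
  weaken le (c , d , c≤b) = c , d , ≤-trans c≤b le

  var≤ : ∀ {m} {ρ : Vec Tree m} i → ρ ⊢ var i ⇓ lookup ρ i [≤ 1 ]
  var≤ i = 1 , var , ≤-refl

  nil≤ : ∀ {m} {ρ : Vec Tree m} → ρ ⊢ nil ⇓ nil [≤ 1 ]
  nil≤ = 1 , nil , ≤-refl

  cons≤ : ∀ {m} {ρ : Vec Tree m} {e₁ e₂ t₁ t₂ b₁ b₂} →
          ρ ⊢ e₁ ⇓ t₁ [≤ b₁ ] → ρ ⊢ e₂ ⇓ t₂ [≤ b₂ ] → ρ ⊢ cons e₁ e₂ ⇓ t₁ ∙ t₂ [≤ 1 + (b₁ + b₂) ]
  cons≤ (_ , d₁ , l₁) (_ , d₂ , l₂) = _ , cons d₁ d₂ , s≤s (+-mono-≤ l₁ l₂)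

  let≤ : ∀ {m} {ρ : Vec Tree m} {e₁ e₂ t₁ t₂ b₁ b₂} →
         ρ ⊢ e₁ ⇓ t₁ [≤ b₁ ] → t₁ ∷ ρ ⊢ e₂ ⇓ t₂ [≤ b₂ ] → ρ ⊢ let′ e₁ e₂ ⇓ t₂ [≤ 1 + (b₁ + b₂) ]
  let≤ (_ , d₁ , l₁) (_ , d₂ , l₂) = _ , let′ d₁ d₂ , s≤s (+-mono-≤ l₁ l₂)

  case-nil≤ : ∀ {m} {ρ : Vec Tree m} {e e₁ e₂ t b b₁} →
              ρ ⊢ e ⇓ nil [≤ b ] → ρ ⊢ e₁ ⇓ t [≤ b₁ ] → ρ ⊢ case e e₁ e₂ ⇓ t [≤ 1 + (b + b₁) ]
  case-nil≤ (_ , d₁ , l₁) (_ , d₂ , l₂) = _ , case-nil d₁ d₂ , s≤s (+-mono-≤ l₁ l₂)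

  case-cons≤ : ∀ {m} {ρ : Vec Tree m} {e e₁ e₂ s₁ s₂ t b b₂} →
               ρ ⊢ e ⇓ s₁ ∙ s₂ [≤ b ] → s₁ ∷ s₂ ∷ ρ ⊢ e₂ ⇓ t [≤ b₂ ] → ρ ⊢ case e e₁ e₂ ⇓ t [≤ 1 + (b + b₂) ]
  case-cons≤ (_ , d₁ , l₁) (_ , d₂ , l₂) = _ , case-cons d₁ d₂ , s≤s (+-mono-≤ l₁ l₂)

  call≤ : ∀ {m} {ρ : Vec Tree m} {f e s t b b′} →
          ρ ⊢ e ⇓ s [≤ b ] → s ∷ [] ⊢ lookup P f ⇓ t [≤ b′ ] → ρ ⊢ call f e ⇓ t [≤ 1 + (b + b′) ]
  call≤ (_ , d₁ , l₁) (_ , d₂ , l₂) = _ , call d₁ d₂ , s≤s (+-mono-≤ l₁ l₂)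

  case-head≤ : ∀ {m} {ρ : Vec Tree m} {e t b} → ρ ⊢ e ⇓ t [≤ b ] →
               ρ ⊢ case e nil (var 0F) ⇓ head t [≤ 2 + b ]
  case-head≤ {t = nil}   {b} d = weaken (≤-reflexive (cong suc (+-comm b 1))) (case-nil≤ d nil≤)
  case-head≤ {t = _ ∙ _} {b} d = weaken (≤-reflexive (cong suc (+-comm b 1))) (case-cons≤ d (var≤ 0F))

  case-tail≤ : ∀ {m} {ρ : Vec Tree m} {e t b} → ρ ⊢ e ⇓ t [≤ b ] →
               ρ ⊢ case e nil (var 1F) ⇓ tail t [≤ 2 + b ]
  case-tail≤ {t = nil}   {b} d = weaken (≤-reflexive (cong suc (+-comm b 1))) (case-nil≤ d nil≤)
  case-tail≤ {t = _ ∙ _} {b} d = weaken (≤-reflexive (cong suc (+-comm b 1))) (case-cons≤ d (var≤ 1F))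

  tailExpr≤ : ∀ {m} {ρ : Vec Tree m} {t} i → t ∷ ρ ⊢ tailExpr i (var 0F) ⇓ tails i t [≤ tailCost i ]
  tailExpr≤ zero    = var≤ 0F
  tailExpr≤ (suc i) = case-tail≤ (tailExpr≤ i)

  module _ (κ : Tree) where

    -- The trailing variables are arbitrary because compiled code is placed under various binders;
    -- it reads only variable 0.
    Evaluates : ∀ {m} → Vec Tree m → (∀ {j} → Expr (suc k) (suc j)) → Tree → ℕ → Set
    Evaluates ρ e t b = ∀ {j} (ρ′ : Vec Tree j) → pack ρ κ ∷ ρ′ ⊢ e ⇓ t [≤ b ]

    -- Induction on the remaining clock `κ′`; the full clock `κ` stays in the environment for folds
    -- inside the body.
    fold≤ : ∀ {m} {ρ : Vec Tree m} {e : ∀ {j} → Expr (suc k) (suc j)} {f : Tree → Tree → Tree} {b} self →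
            lookup P self ≡ foldBody self e →
            (∀ x acc → Evaluates (x ∷ acc ∷ ρ) e (f x acc) b) →
            ∀ κ′ l z → ((κ′ ∙ l) ∙ (z ∙ pack ρ κ)) ∷ [] ⊢ lookup P self
                         ⇓ foldTree (spine κ′) f z l [≤ foldCost b (spine κ′) ]
    fold≤ {ρ = ρ} {e} {f} {b} self eq ev κ′ l z rewrite eq = go κ′ l
      where
      go : ∀ κ′ l → ((κ′ ∙ l) ∙ (z ∙ pack ρ κ)) ∷ [] ⊢ foldBody self e ⇓ foldTree (spine κ′) f z l [≤ foldCost b (spine κ′) ]
      go nil l = weaken (≤ᵇ⇒≤ _ 10 _) (case-cons≤ (var≤ 0F) (case-cons≤ (var≤ 0F) (case-nil≤ (var≤ 0F) (case-head≤ (var≤ 3F)))))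
      go (_ ∙ κ″) nil =
        weaken (m≤n⇒m≤n+o _ (≤ᵇ⇒≤ _ 23 _))
          (case-cons≤ (var≤ 0F) (case-cons≤ (var≤ 0F) (case-cons≤ (var≤ 0F) (case-nil≤ (var≤ 3F) (case-head≤ (var≤ 5F))))))
      go (_ ∙ κ″) (x ∙ l) =
        weaken (≤-reflexive (fold-arith (foldCost b (spine κ″)) b))
          (case-cons≤ (var≤ 0F) (case-cons≤ (var≤ 0F) (case-cons≤ (var≤ 0F) (case-cons≤ (var≤ 3F)
            (let≤ (call≤ (cons≤ (cons≤ (var≤ 3F) (var≤ 1F)) (var≤ 7F)) (fold≤ {e = e} self eq ev κ″ l z))
              (case-cons≤ (var≤ 8F)
                (let≤ (cons≤ (var≤ 3F) (cons≤ (var≤ 2F) (var≤ 1F))) (ev x _ _))))))))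

    compile≤ : ∀ {m} (c : Code m) (ι : Fin (folds c) → Fin (suc k)) →
               (∀ i → lookup P (ι i) ≡ bodies c ι i) →
               ∀ ρ → Evaluates ρ (compile c ι) (⟦ c ⟧ (spine κ) ρ) (cost c (spine κ))
    compile≤ (var i) ι linked ρ ρ′ rewrite sym (head-tails i ρ κ) = case-head≤ (tailExpr≤ (toℕ i))
    compile≤ nil ι linked ρ ρ′ = nil≤
    compile≤ (cons c d) ι linked ρ ρ′ =
      cons≤ (compile≤ c _ (linkedˡ linked) ρ ρ′) (compile≤ d _ (linkedʳ linked) ρ ρ′)
    compile≤ (hd c) ι linked ρ ρ′ = case-head≤ (compile≤ c ι linked ρ ρ′)
    compile≤ (tl c) ι linked ρ ρ′ = case-tail≤ (compile≤ c ι linked ρ ρ′)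
    compile≤ (if c d e) ι linked ρ ρ′ with ⟦ c ⟧ (spine κ) ρ | compile≤ c _ (linkedˡ linked) ρ ρ′
    ... | nil | ev =
      weaken (≤-trans (s≤s (+-monoʳ-≤ (cost c (spine κ)) (m≤n+m _ (cost d (spine κ))))) (m≤n+m _ 2))
        (case-nil≤ ev (compile≤ e _ (linkedʳ {folds d} (linkedʳ {folds c} linked)) ρ ρ′))
    ... | _ ∙ _ | ev =
      weaken (≤-trans (≤-reflexive (if-arith (cost c (spine κ)) (cost d (spine κ))))
                      (+-monoʳ-≤ 3 (+-monoʳ-≤ (cost c (spine κ)) (m≤m+n _ _))))
        (case-cons≤ ev (let≤ (var≤ 2F) (compile≤ d _ (linkedˡ (linkedʳ {folds c} linked)) ρ _)))
    compile≤ (let′ c d) ι linked ρ ρ′ =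
      weaken (≤-reflexive (let-arith (cost c (spine κ)) (cost d (spine κ))))
        (let≤ (cons≤ (compile≤ c _ (linkedˡ linked) ρ ρ′) (var≤ 0F)) (compile≤ d _ (linkedʳ linked) _ _))
    compile≤ {m} (fold c d e) ι linked ρ ρ′ =
      weaken (≤-reflexive (call-arith (tailCost m) (cost c (spine κ)) (cost d (spine κ))
                                      (foldCost (cost e (spine κ)) (spine κ))))
        (call≤ (cons≤ (cons≤ clock (compile≤ c _ (linkedˡ (linked ∘ suc)) ρ ρ′))
                      (cons≤ (compile≤ d _ (linkedˡ (linkedʳ {folds c} (linked ∘ suc))) ρ ρ′) (var≤ 0F)))
               (fold≤ {e = compile e _} (ι 0F) (linked 0F)
                 (λ x acc → compile≤ e _ (linkedʳ {folds d} (linkedʳ {folds c} (linked ∘ suc))) _) κ _ _))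
      where
      clock : pack ρ κ ∷ ρ′ ⊢ tailExpr m (var 0F) ⇓ κ [≤ tailCost m ]
      clock = subst (λ t → pack ρ κ ∷ ρ′ ⊢ tailExpr m (var 0F) ⇓ t [≤ tailCost m ]) (tails-pack ρ κ) (tailExpr≤ m)

-- The clock is longer by 2 than the adjacency matrix, because Dominator
-- searches a list of 2 + n candidates.
program : (c : Code 1) → Program (folds c)
program c = entry ∷ Vec.tabulate (bodies c suc)
  where
  entry = case (var 0F) nil (let′ (cons (var 2F) (cons nil (cons nil (var 0F)))) (compile c suc))

program-runs : ∀ c g h → Run program c On g ∙ h Yields ⟦ c ⟧ (2 + spine g) ((g ∙ h) ∷ [])
                           Within (10 + cost c (2 + spine g))
program-runs c g h =
  case-cons≤ P (var≤ P 0F) (let≤ P (cons≤ P (var≤ P 2F) (cons≤ P (nil≤ P) (cons≤ P (nil≤ P) (var≤ P 0F))))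
    (compile≤ P (nil ∙ (nil ∙ g)) c suc (lookup∘tabulate (bodies c suc)) ((g ∙ h) ∷ []) _))
  where P = program c

-- Polynomial bounds on the cost

PolynomiallyBounded : (ℕ → ℕ) → Set
PolynomiallyBounded f = ∃[ a ] ∃[ d ] ∀ N → f N ≤ a * suc N ^ d

constant-poly : ∀ k → PolynomiallyBounded (λ _ → k)
constant-poly k = k , 0 , λ N → ≤-reflexive (sym (*-identityʳ k))

infixr 6 _+-poly_
-- Degrees are added instead of maximized, which is sound because the base `suc N` is at least 1.
_+-poly_ : ∀ {f g} → PolynomiallyBounded f → PolynomiallyBounded g → PolynomiallyBounded (λ N → f N + g N)
_+-poly_ {f} {g} (a , d , f≤) (b , e , g≤) = a + b , d + e , λ N → begin
  f N + g N                                     ≤⟨ +-mono-≤ (f≤ N) (g≤ N) ⟩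
  a * suc N ^ d + b * suc N ^ e                 ≤⟨ +-mono-≤ (*-monoʳ-≤ a (^-monoʳ-≤ (suc N) (m≤m+n d e)))
                                                            (*-monoʳ-≤ b (^-monoʳ-≤ (suc N) (m≤n+m e d))) ⟩
  a * suc N ^ (d + e) + b * suc N ^ (d + e)     ≡⟨ *-distribʳ-+ (suc N ^ (d + e)) a b ⟨
  (a + b) * suc N ^ (d + e)                     ∎
  where open ≤-Reasoning

suc*-poly : ∀ {f} → PolynomiallyBounded f → PolynomiallyBounded (λ N → suc N * f N)
suc*-poly {f} (a , d , f≤) = a , suc d , λ N → begin
  suc N * f N             ≤⟨ *-monoʳ-≤ (suc N) (f≤ N) ⟩
  suc N * (a * suc N ^ d) ≡⟨ *-assoc (suc N) a _ ⟨
  suc N * a * suc N ^ d   ≡⟨ cong (_* suc N ^ d) (*-comm (suc N) a) ⟩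
  a * suc N * suc N ^ d   ≡⟨ *-assoc a (suc N) _ ⟩
  a * suc N ^ suc d       ∎
  where open ≤-Reasoning

≤-poly : ∀ {f g} → (∀ N → f N ≤ g N) → PolynomiallyBounded g → PolynomiallyBounded f
≤-poly f≤g (a , d , g≤) = a , d , λ N → ≤-trans (f≤g N) (g≤ N)

foldCost≤ : ∀ b N → foldCost b N ≤ suc N * (23 + b)
foldCost≤ b zero    = ≤-trans (≤ᵇ⇒≤ 10 23 _) (≤-trans (m≤m+n 23 b) (m≤m+n (23 + b) 0))
foldCost≤ b (suc N) = begin
  23 + (foldCost b N + b)       ≡⟨ rearrange (foldCost b N) b ⟩
  23 + b + foldCost b N         ≤⟨ +-monoʳ-≤ (23 + b) (foldCost≤ b N) ⟩
  23 + b + suc N * (23 + b)     ∎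
  where
  open ≤-Reasoning
  rearrange : ∀ f b → 23 + (f + b) ≡ 23 + b + f
  rearrange = solve-∀

cost-poly : ∀ {m} (c : Code m) → PolynomiallyBounded (cost c)
cost-poly (var i)          = constant-poly (2 + tailCost (toℕ i))
cost-poly nil              = constant-poly 1
cost-poly (cons c d)       = constant-poly 1 +-poly cost-poly c +-poly cost-poly d
cost-poly (hd c)           = constant-poly 2 +-poly cost-poly c
cost-poly (tl c)           = constant-poly 2 +-poly cost-poly c
cost-poly (if c d e)       = constant-poly 3 +-poly cost-poly c +-poly cost-poly d +-poly cost-poly e
cost-poly (let′ c d)       = constant-poly 3 +-poly cost-poly c +-poly cost-poly d
cost-poly {m} (fold c d e) =
  constant-poly 5 +-poly constant-poly (tailCost m) +-poly cost-poly c +-poly cost-poly d +-poly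
  ≤-poly (λ N → foldCost≤ (cost e N) N) (suc*-poly (constant-poly 23 +-poly cost-poly e))

-- The program

data Decides : Tree → Set → Set₁ where
  reject  : ∀ {P : Set} → ¬ P → Decides nil P
  accept : ∀ {s t} {P : Set} → P → Decides (s ∙ t) P

decides-map : ∀ {t} {P Q : Set} → (P → Q) → (Q → P) → Decides t P → Decides t Q
decides-map f g (reject ¬p) = reject (¬p ∘ g)
decides-map f g (accept p) = accept (f p)

decides-spine : ∀ t → Decides t (0 < spine t)
decides-spine nil     = reject λ ()
decides-spine (_ ∙ _) = accept (s≤s z≤n)

decides-bool : ∀ b → Decides (encodeBool b) (T b)
decides-bool false = reject λ ()
decides-bool true  = accept _

encodeMaybe : ∀ {A : Set} → (A → Tree) → Maybe A → Tree
encodeMaybe enc nothing  = nil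
encodeMaybe enc (just x) = enc x ∙ nil

spine-encodeℕ : ∀ k → spine (encodeℕ k) ≡ k
spine-encodeℕ zero    = refl
spine-encodeℕ (suc k) = cong suc (spine-encodeℕ k)

spine-encodeList : ∀ {A : Set} (enc : A → Tree) xs → spine (encodeList enc xs) ≡ length xs
spine-encodeList enc []       = refl
spine-encodeList enc (x ∷ xs) = cong suc (spine-encodeList enc xs)

spine-tails : ∀ i t → spine (tails i t) ≡ spine t ∸ i
spine-tails zero    t       = refl
spine-tails (suc i) nil     = trans (cong spine (sym (tails-tail i nil))) (trans (spine-tails i nil) (0∸n≡0 i))
spine-tails (suc i) (_ ∙ t) = trans (cong spine (sym (tails-tail i (_ ∙ t)))) (spine-tails i t)

head-tails-tabulate : ∀ {A : Set} {n} (enc : A → Tree) (f : Fin n → A) i →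
                      head (tails (toℕ i) (encodeList enc (List.tabulate f))) ≡ enc (f i)
head-tails-tabulate enc f zero    = refl
head-tails-tabulate enc f (suc i) =
  trans (cong head (sym (tails-tail (toℕ i) _))) (head-tails-tabulate enc (f ∘ suc) i)

not : ∀ {m} → Code m → Code m
not c = if c nil (cons nil nil)

and : ∀ {m} → Code m → Code m → Code m
and c d = if c d nil

-- Removes as many entries from d as there are in c; so the result is nil
-- unless c, as a list or a unary number, is shorter than d.
drop : ∀ {m} → Code m → Code m → Code m
drop c d = fold c d (tl (var 1F))

-- Only lengths are compared: two unary numbers agree if neither outlasts the other.
equal : ∀ {m} → Code m → Code m → Code m
equal c d = not (if (drop c d) (cons nil nil) (drop d c))

find : ∀ {m} → Code m → Code (2 + m) → Code m
find l p = fold l nil (if p (cons (var 0F) nil) (var 1F))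

map : ∀ {m} → Code m → Code (2 + m) → Code m
map l f = fold l nil (cons f (var 1F))

-- Each row of the matrix prepends the successor of the current head, so the vertices come out in
-- descending order.
vertexList : ∀ {m} → Code m → Code m
vertexList g = fold g nil (if (var 1F) (cons (cons nil (hd (var 1F))) (var 1F)) (cons nil nil))

edge : ∀ {m} → Code m → Code m → Code m → Code m
edge g i j = hd (drop j (hd (drop i g)))

owns : ∀ {m} → Code m → Code m → Code m
owns i c = if (tl c) (equal (hd (tl c)) i) nil

↑↑ : ∀ {m} → Fin m → Fin (2 + m)
↑↑ i = suc (suc i)

-- The variables g, S and V hold the adjacency matrix, the bids and the vertices.
unassigned : ∀ {m} → (S V : Fin m) → Code m
unassigned S V = find (var V) (not (find (var (↑↑ S)) (owns (var 2F) (var 0F))))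

-- A cell is an object followed by its bids, so its length is the price plus 1, and `drop` applied
-- to two cells compares prices.
cheapest : ∀ {m} → (g S i : Fin m) → Code m
cheapest g S i =
  find (var S)
    (and (edge (var (↑↑ g)) (var (↑↑ i)) (hd (var 0F)))
         (not (find (var (↑↑ S))
           (and (edge (var (↑↑ (↑↑ g))) (var (↑↑ (↑↑ i))) (hd (var 0F)))
                (drop (var 0F) (var 2F))))))

placeBid : ∀ {m} → (S i j : Fin m) → Code m
placeBid S i j =
  map (var S) (if (equal (hd (var 0F)) (var (↑↑ j)))
                  (cons (hd (var 0F)) (cons (var (↑↑ i)) (tl (var 0F))))
                  (var 0F))

step : ∀ {m} → (g S V : Fin m) → Code m
step g S V =
  let′ (unassigned S V)
    (if (var 0F)
        (let′ (hd (var 0F))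
          (let′ (hd (hd (cheapest (↑↑ g) (↑↑ S) 0F)))
            (placeBid (suc (↑↑ S)) 1F 0F)))
        (var (suc S)))

-- The folded entries are ignored: two nested loops over n + 1 entries make (n + 1)² steps, more
-- than the sum of prices can ever reach. Steps after the end of the auction change nothing.
auction : ∀ {m} → (g S V : Fin m) → Code m
auction g S V =
  fold (cons nil (var g)) (var S)
    (fold (cons nil (var (↑↑ g))) (var 1F) (step (↑↑ (↑↑ g)) 1F (↑↑ (↑↑ V))))

respond : ∀ {m} → (S V h v : Fin m) → Code m
respond S V h v =
  find (cons (hd (tl (hd (find (var S) (equal (hd (var 0F)) (var (↑↑ v)))))))
         (cons (hd (hd (find (var S) (owns (var (↑↑ v)) (var 0F)))))
           (var V)))
       (not (find (var (↑↑ h)) (equal (tl (var 0F)) (var 2F))))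

-- Opaque, because the nested folds have huge normal forms.
opaque
  main : Code 1
  main =
    let′ (hd (var 0F))
      (let′ (vertexList (var 0F))
        (let′ (map (var 0F) (cons (var 0F) nil))
          (let′ (auction 2F 0F 1F)
            (let′ (tl (var 4F))
              -- On the empty history this yields `nil`, the code of vertex 0, so an opening move is
              -- computed as if vertex 0 had just been played.
              (let′ (tl (hd (var 0F)))
                (hd (respond 2F 4F 1F 0F)))))))

-- Correctness of the program

descending : ∀ {n} k → k ≤ n → List (Fin n)
descending zero    _   = []
descending (suc k) k<n = fromℕ< k<n ∷ descending k (<⇒≤ k<n)

∈-descending : ∀ {n} {v : Fin n} k (k≤n : k ≤ n) → toℕ v < k → v ∈ descending k k≤n
∈-descending {v = v} (suc k) k<n (s≤s v≤k) with m≤n⇒m<n∨m≡n v≤k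
... | inj₁ v<k = there (∈-descending k (<⇒≤ k<n) v<k)
... | inj₂ v≡k = here (toℕ-injective (trans v≡k (sym (toℕ-fromℕ< k<n))))

length-descending : ∀ {n} k (k≤n : k ≤ n) → length (descending k k≤n) ≡ k
length-descending zero    _   = refl
length-descending (suc k) k<n = cong suc (length-descending k (<⇒≤ k<n))

vertices : ∀ n → List (Fin n)
vertices n = descending n ≤-refl

∈-vertices : ∀ {n} (v : Fin n) → v ∈ vertices n
∈-vertices v = ∈-descending _ ≤-refl (toℕ<n v)

encodeCell : ∀ {n} → Bids n → Fin n → Tree
encodeCell B j = encodeVertex j ∙ encodeList encodeVertex (B j)

encodeBids : ∀ {n} → Bids n → Tree
encodeBids {n} B = encodeList (encodeCell B) (vertices n)

spine-encodeVertex : ∀ {n} (v : Fin n) → spine (encodeVertex v) ≡ toℕ v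
spine-encodeVertex v = spine-encodeℕ (toℕ v)

spine-encodeGraph : ∀ {n} (G : Graph n) → spine (encodeGraph G) ≡ n
spine-encodeGraph {n} G = trans (spine-encodeList _ (allFin n)) (length-tabulate id)

opaque
  auctionTree : ℕ → Tree → Tree → Tree → Tree
  auctionTree N s t u = ⟦ auction 0F 1F 2F ⟧ N (s ∷ t ∷ u ∷ [])

  auction-lookup : ∀ {m N} {ρ : Vec Tree m} {g S V : Fin m} →
                   ⟦ auction g S V ⟧ N ρ ≡ auctionTree N (lookup ρ g) (lookup ρ S) (lookup ρ V)
  auction-lookup = refl

-- Rules for what code evaluates to and decides

if-cons : ∀ {t s s′ x y} → t ≡ s ∙ s′ → (if t then x else y) ≡ x
if-cons refl = refl

infix 4 _,_⊨_evaluatesTo_ _,_⊨_decides_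

-- Wrapping the semantics in records lets Agda infer N, ρ and c.
record _,_⊨_evaluatesTo_ {m} (N : ℕ) (ρ : Vec Tree m) (c : Code m) (t : Tree) : Set where
  constructor value
  field equation : ⟦ c ⟧ N ρ ≡ t

record _,_⊨_decides_ {m} (N : ℕ) (ρ : Vec Tree m) (c : Code m) (P : Set) : Set₁ where
  constructor test
  field decision : Decides (⟦ c ⟧ N ρ) P

open _,_⊨_evaluatesTo_
open _,_⊨_decides_

module _ {N m : ℕ} {ρ : Vec Tree m} where

  test-map : ∀ {c} {P Q : Set} → (P → Q) → (Q → P) → N , ρ ⊨ c decides P → N , ρ ⊨ c decides Q
  test-map f g (test d) = test (decides-map f g d)

  let-spec : ∀ {c d s t} → N , ρ ⊨ c evaluatesTo s → N , s ∷ ρ ⊨ d evaluatesTo t → N , ρ ⊨ let′ c d evaluatesTo t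
  let-spec (value refl) (value eq) = value eq

  hd-spec : ∀ {c t} → N , ρ ⊨ c evaluatesTo t → N , ρ ⊨ hd c evaluatesTo head t
  hd-spec (value refl) = value refl

  not-spec : ∀ {c} {P : Set} → N , ρ ⊨ c decides P → N , ρ ⊨ not c decides (¬ P)
  not-spec {c} (test d) with ⟦ c ⟧ N ρ in eq | d
  ... | _ | reject ¬p = test (subst (λ t → Decides (if t then nil else nil ∙ nil) _) (sym eq) (accept ¬p))
  ... | _ | accept p  = test (subst (λ t → Decides (if t then nil else nil ∙ nil) _) (sym eq) (reject λ ¬p → ¬p p))

  and-spec : ∀ {c d} {P Q : Set} → N , ρ ⊨ c decides P → N , ρ ⊨ d decides Q → N , ρ ⊨ and c d decides (P × Q)
  and-spec {c} {d} {P} {Q} (test dp) (test dq) = test (go dp)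
    where
    go : ∀ {t} → Decides t P → Decides (if t then ⟦ d ⟧ N ρ else nil) (P × Q)
    go (reject ¬p) = reject (¬p ∘ proj₁)
    go (accept p)  = decides-map (p ,_) proj₂ dq

  drop-spec : ∀ {c d s t} → N , ρ ⊨ c evaluatesTo s → N , ρ ⊨ d evaluatesTo t → spine s ≤ N →
              N , ρ ⊨ drop c d evaluatesTo tails (spine s) t
  drop-spec (value refl) (value refl) = value ∘ go N _
    where
    go : ∀ {z} M t → spine t ≤ M → foldTree M (λ _ → tail) z t ≡ tails (spine t) z
    go zero    nil     _         = refl
    go (suc M) nil     _         = refl
    go (suc M) (_ ∙ t) (s≤s t≤M) = cong tail (go M t t≤M)

  shorter-spec : ∀ {c d s t} → N , ρ ⊨ c evaluatesTo s → N , ρ ⊨ d evaluatesTo t → spine s ≤ N →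
                 N , ρ ⊨ drop c d decides (spine s < spine t)
  shorter-spec {s = s} {t} c≡ d≡ s≤N = test (subst (λ u → Decides u _) (sym (equation (drop-spec c≡ d≡ s≤N)))
    (decides-map (0<n∸m⇒m<n ∘ subst (0 <_) (spine-tails (spine s) t))
                 (subst (0 <_) (sym (spine-tails (spine s) t)) ∘ m<n⇒0<n∸m)
                 (decides-spine (tails (spine s) t))))
    where
    0<n∸m⇒m<n : ∀ {m n} → 0 < n ∸ m → m < n
    0<n∸m⇒m<n lt = ≰⇒> λ n≤m → contradiction (m≤n⇒m∸n≡0 n≤m) (>⇒≢ lt)

  equal-spec : ∀ {c d s t} → N , ρ ⊨ c evaluatesTo s → N , ρ ⊨ d evaluatesTo t → spine s ≤ N → spine t ≤ N →
               N , ρ ⊨ equal c d decides (spine s ≡ spine t)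
  equal-spec {s = s} {t} c≡ d≡ s≤N t≤N =
    test (go (decision (shorter-spec c≡ d≡ s≤N)) (decision (shorter-spec d≡ c≡ t≤N)))
    where
    go : ∀ {u v} → Decides u (spine s < spine t) → Decides v (spine t < spine s) →
         Decides (if (if u then nil ∙ nil else v) then nil else nil ∙ nil) (spine s ≡ spine t)
    go (accept s<t) _            = reject (<⇒≢ s<t)
    go (reject s≮t) (accept t<s) = reject (>⇒≢ t<s)
    go (reject s≮t) (reject t≮s) = accept (≤-antisym (≮⇒≥ t≮s) (≮⇒≥ s≮t))

  -- `r` is constructed along the run of the fold; Dominator's moves originate here.
  find-spec : ∀ {A : Set} {enc : A → Tree} {P : A → Set} {l p} xs →
              (∀ x acc → N , enc x ∷ acc ∷ ρ ⊨ p decides P x) →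
              N , ρ ⊨ l evaluatesTo encodeList enc xs →
              ∃[ r ] Search P (take N xs) r × N , ρ ⊨ find l p evaluatesTo encodeMaybe enc r
  find-spec {enc = enc} {P} {l} {p} xs dec (value eq) with ⟦ l ⟧ N ρ in eq′ | eq
  ... | _ | refl with go N xs
    where
    body : Tree → Tree → Tree
    body x acc = ⟦ if p (cons (var 0F) nil) (var 1F) ⟧ N (x ∷ acc ∷ ρ)
    go : ∀ M xs → ∃[ r ] Search P (take M xs) r × foldTree M body nil (encodeList enc xs) ≡ encodeMaybe enc r
    go zero    xs       = nothing , none , refl
    go (suc M) []       = nothing , none , refl
    go (suc M) (x ∷ xs) with go M xs
    ... | r , s , eq rewrite eq with ⟦ p ⟧ N (enc x ∷ encodeMaybe enc r ∷ ρ) | decision (dec x (encodeMaybe enc r))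
    ...   | _ | accept px  = just x , here px , refl
    ...   | _ | reject ¬px = r , there ¬px s , refl
  ...   | r , s , eq″ = r , s , value (trans (cong (foldTree N _ nil) eq′) eq″)

  any-spec : ∀ {A : Set} {enc : A → Tree} {P : A → Set} {l p} xs →
             (∀ x acc → N , enc x ∷ acc ∷ ρ ⊨ p decides P x) →
             N , ρ ⊨ l evaluatesTo encodeList enc xs →
             N , ρ ⊨ find l p decides (∃[ x ] x ∈ take N xs × P x)
  any-spec xs dec l≡ with find-spec xs dec l≡
  ... | nothing , s , value eq = test (subst (λ t → Decides t _) (sym eq) (reject λ (x , x∈xs , px) → search-nothing s x∈xs px))
  ... | just x  , s , value eq = test (subst (λ t → Decides t _) (sym eq) (accept (x , search-∈ s , search-just s)))
    where
    search-∈ : ∀ {A : Set} {P : A → Set} {xs x} → Search P xs (just x) → x ∈ xs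
    search-∈ (here _)    = here refl
    search-∈ (there _ s) = there (search-∈ s)

  map-spec : ∀ {A : Set} {enc enc′ : A → Tree} {l f} xs → length xs ≤ N →
             (∀ x acc → N , enc x ∷ acc ∷ ρ ⊨ f evaluatesTo enc′ x) →
             N , ρ ⊨ l evaluatesTo encodeList enc xs → N , ρ ⊨ map l f evaluatesTo encodeList enc′ xs
  map-spec {enc = enc} {enc′} {f = f} xs len f≡ (value eq) = value (trans (cong (foldTree N _ nil) eq) (go N xs len))
    where
    go : ∀ M xs → length xs ≤ M →
         foldTree M (λ x acc → ⟦ f ⟧ N (x ∷ acc ∷ ρ) ∙ acc) nil (encodeList enc xs) ≡ encodeList enc′ xs
    go zero    []       _         = refl
    go (suc M) []       _         = refl
    go (suc M) (x ∷ xs) (s≤s len) = cong₂ _∙_ (equation (f≡ x _)) (go M xs len)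

module Specs {n N : ℕ} (n+2≤N : 2 + n ≤ N) where

  n≤N : n ≤ N
  n≤N = ≤-trans (m≤n+m n 2) n+2≤N

  vertex≤N : ∀ (v : Fin n) → spine (encodeVertex v) ≤ N
  vertex≤N v = ≤-trans (≤-reflexive (spine-encodeVertex v)) (≤-trans (<⇒≤ (toℕ<n v)) n≤N)

  vertices≤N : length (vertices n) ≤ N
  vertices≤N = ≤-trans (≤-reflexive (length-descending n ≤-refl)) n≤N

  take-vertices : take N (vertices n) ≡ vertices n
  take-vertices = take-all N _ vertices≤N

  ∈-take-vertices : ∀ j → j ∈ take N (vertices n)
  ∈-take-vertices j = subst (j ∈_) (sym take-vertices) (∈-vertices j)

  vertexList-spec : ∀ {m} {ρ : Vec Tree m} {g t} → N , ρ ⊨ g evaluatesTo t → spine t ≡ n →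
                    N , ρ ⊨ vertexList g evaluatesTo encodeList encodeVertex (vertices n)
  vertexList-spec {t = t} (value refl) len = value (go N t ≤-refl n≤N len)
    where
    extend : Tree → Tree → Tree
    extend _ acc = if acc then (nil ∙ head acc) ∙ acc else nil ∙ nil
    go : ∀ {k} M t (k≤n : k ≤ n) → k ≤ M → spine t ≡ k →
         foldTree M extend nil t ≡ encodeList encodeVertex (descending k k≤n)
    go zero    nil       k≤n k≤M refl = refl
    go (suc M) nil       k≤n k≤M refl = refl
    go (suc M) (s ∙ t)   k≤n (s≤s k≤M) refl
      rewrite go M t (<⇒≤ k≤n) k≤M refl | toℕ-fromℕ< k≤n = last (spine t) (<⇒≤ k≤n)
      where
      last : ∀ k (k≤n : k ≤ n) → extend s (encodeList encodeVertex (descending k k≤n)) ≡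
                                 encodeℕ k ∙ encodeList encodeVertex (descending k k≤n)
      last zero    _   = refl
      last (suc k) k<n rewrite toℕ-fromℕ< k<n = refl

  vertex-equal : ∀ {m} {ρ : Vec Tree m} {c d} (u v : Fin n) → N , ρ ⊨ c evaluatesTo encodeVertex u →
                 N , ρ ⊨ d evaluatesTo encodeVertex v → N , ρ ⊨ equal c d decides (u ≡ v)
  vertex-equal u v c≡ d≡ = test-map
    (λ s≡s → toℕ-injective (trans (sym (spine-encodeVertex u)) (trans s≡s (spine-encodeVertex v))))
    (λ { refl → refl })
    (equal-spec c≡ d≡ (vertex≤N u) (vertex≤N v))

  nth-spec : ∀ {m} {ρ : Vec Tree m} {A : Set} (enc : A → Tree) (f : Fin n → A) {c d} i →
             N , ρ ⊨ c evaluatesTo encodeVertex i →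
             N , ρ ⊨ d evaluatesTo encodeList enc (List.tabulate f) → N , ρ ⊨ hd (drop c d) evaluatesTo enc (f i)
  nth-spec {ρ = ρ} enc f {c} {d} i c≡ d≡ = value (begin
    head (⟦ drop c d ⟧ N ρ)                                 ≡⟨ cong head (equation (drop-spec c≡ d≡ (vertex≤N i))) ⟩
    head (tails (spine (encodeVertex i)) (encodeList enc (List.tabulate f)))
      ≡⟨ cong (λ k → head (tails k (encodeList enc (List.tabulate f)))) (spine-encodeVertex i) ⟩
    head (tails (toℕ i) (encodeList enc (List.tabulate f))) ≡⟨ head-tails-tabulate enc f i ⟩
    enc (f i)                                               ∎)
    where open ≡-Reasoning

  edge-spec : ∀ {m} {ρ : Vec Tree m} (G : Graph n) {g c d} i j → N , ρ ⊨ g evaluatesTo encodeGraph G →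
              N , ρ ⊨ c evaluatesTo encodeVertex i → N , ρ ⊨ d evaluatesTo encodeVertex j →
              N , ρ ⊨ edge g c d decides Adj G i j
  edge-spec G i j g≡ c≡ d≡ = test (subst (λ t → Decides t (Adj G i j))
    (sym (equation (nth-spec (λ v → encodeBool (adj G i v)) id j d≡
      (nth-spec (λ u → encodeList (λ v → encodeBool (adj G u v)) (allFin n)) id i c≡ g≡))))
    (decides-bool (adj G i j)))

  owns-spec : ∀ {m} {ρ : Vec Tree m} (B : Bids n) {c d} i j → N , ρ ⊨ c evaluatesTo encodeVertex i →
              N , ρ ⊨ d evaluatesTo encodeCell B j → N , ρ ⊨ owns c d decides Owns B i j
  owns-spec {ρ = ρ} B {c} {d} i j c≡ d≡ = test (go (B j) refl (cong tail (equation d≡)))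
    where
    go : ∀ b → b ≡ B j → tail (⟦ d ⟧ N ρ) ≡ encodeList encodeVertex (B j) → Decides (⟦ owns c d ⟧ N ρ) (Owns B i j)
    go b b≡ tl≡ with trans tl≡ (cong (encodeList encodeVertex) (sym b≡))
    go []      b≡ _ | tl≡ rewrite tl≡ = reject λ o → contradiction (trans (cong List.head b≡) o) λ ()
    go (k ∷ b) b≡ _ | tl≡ = subst (λ t → Decides t (Owns B i j)) (sym (if-cons tl≡))
      (decides-map (λ { refl → cong List.head (sym b≡) }) (λ o → just-injective (trans (cong List.head b≡) o))
        (decision (vertex-equal {ρ = ρ} {hd (tl d)} {c} k i (value (cong head tl≡)) c≡)))

  placeBid-spec : ∀ {m} {ρ : Vec Tree m} {B : Bids n} {S i j} u v → N , ρ ⊨ var S evaluatesTo encodeBids B →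
                  N , ρ ⊨ var i evaluatesTo encodeVertex u → N , ρ ⊨ var j evaluatesTo encodeVertex v →
                  N , ρ ⊨ placeBid S i j evaluatesTo encodeBids (bid u v B)
  placeBid-spec {m} {ρ} {B} {S} {i} {j} u v S≡ (value i≡) (value j≡) =
    map-spec (vertices n) vertices≤N (λ k acc → value (cell k acc)) S≡
    where
    test-j : Code (2 + m)
    test-j = equal (hd (var 0F)) (var (↑↑ j))
    cell : ∀ k acc → ⟦ if test-j (cons (hd (var 0F)) (cons (var (↑↑ i)) (tl (var 0F)))) (var 0F) ⟧ N
                     (encodeCell B k ∷ acc ∷ ρ) ≡ encodeCell (bid u v B) k
    cell k acc with ⟦ test-j ⟧ N (encodeCell B k ∷ acc ∷ ρ)
                  | decision (vertex-equal {ρ = encodeCell B k ∷ acc ∷ ρ} {hd (var 0F)} {var (↑↑ j)} k v (value refl) (value j≡))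
                  | k ≟ v
    ... | _ | accept k≡v | yes _   = cong (λ t → encodeVertex k ∙ (t ∙ encodeList encodeVertex (B k))) i≡
    ... | _ | accept k≡v | no k≢v  = contradiction k≡v k≢v
    ... | _ | reject k≢v | yes k≡v = contradiction k≡v k≢v
    ... | _ | reject k≢v | no _    = refl

  module _ {r} (G : Graph n) (1≤r : 1 ≤ r) (regular : Regular r G) where
    open Auction G 1≤r regular

    module _ {m} {ρ : Vec Tree m} {B : Bids n} {S : Fin m} (S≡ : lookup ρ S ≡ encodeBids B) where

      unassigned-spec : ∀ {V} → lookup ρ V ≡ encodeList encodeVertex (vertices n) →
        ∃[ r ] Search (λ i → ¬ Assigned B i) (vertices n) r × N , ρ ⊨ unassigned S V evaluatesTo encodeMaybe encodeVertex r
      unassigned-spec V≡ = subst (λ vs → ∃[ r ] Search _ vs r × _ , _ ⊨ _ evaluatesTo encodeMaybe encodeVertex r)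
        take-vertices (find-spec (vertices n) (λ i acc →
          not-spec (test-map (λ (j , _ , o) → j , o) (λ (j , o) → j , ∈-take-vertices j , o)
            (any-spec (vertices n) (λ j acc′ → owns-spec B i j (value refl) (value refl)) (value S≡))))
          (value V≡))

      cheapest-spec : ∀ {g i u} → Invariant B → lookup ρ g ≡ encodeGraph G → lookup ρ i ≡ encodeVertex u →
        ∃[ r ] Search (Cheapest B u) (vertices n) r × N , ρ ⊨ cheapest g S i evaluatesTo encodeMaybe (encodeCell B) r
      cheapest-spec {g} {i} {u} inv g≡ i≡ = subst (λ vs → ∃[ r ] Search _ vs r × _ , _ ⊨ _ evaluatesTo encodeMaybe (encodeCell B) r)
        take-vertices (find-spec (vertices n) (λ j acc →
          test-map (λ (uj , ¬cheaper) → uj , λ k uk → ≮⇒≥ λ lt → ¬cheaper (k , ∈-take-vertices k , uk , lt))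
                   (λ (uj , min) → uj , λ (k , _ , uk , lt) → contradiction (min k uk) (<⇒≱ lt))
            (and-spec (edge-spec G u j (value g≡) (value i≡) (value refl))
              (not-spec (any-spec (vertices n)
                (λ k acc′ → and-spec (edge-spec G u k (value g≡) (value i≡) (value refl)) (cheaper-spec j k))
                (value S≡)))))
          (value S≡))
        where
        spine-cell : ∀ j → spine (encodeCell B j) ≡ suc (price B j)
        spine-cell j = cong suc (spine-encodeList encodeVertex (B j))
        cheaper-spec : ∀ j k {acc acc′} →
          N , encodeCell B k ∷ acc′ ∷ encodeCell B j ∷ acc ∷ ρ ⊨ drop (var 0F) (var 2F) decides (price B k < price B j)
        cheaper-spec j k = test-map
          (λ lt → ≤-pred (subst₂ _<_ (spine-cell k) (spine-cell j) lt))
          (λ lt → subst₂ _<_ (sym (spine-cell k)) (sym (spine-cell j)) (s≤s lt))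
          (shorter-spec (value refl) (value refl)
            -- The price bound already matters for a single comparison: a longer cell would outlast
            -- the clock.
            (≤-trans (≤-reflexive (spine-cell k)) (≤-trans (s≤s (Invariant.bounded inv k)) (≤-trans (n≤1+n _) n+2≤N))))

    -- Either the auction is over, or each of the `k` steps so far was a bid and raised the sum of
    -- the prices.
    Progress : ℕ → Tree → Set
    Progress k t = ∃[ B ] t ≡ encodeBids B × Invariant B × ((∀ i → Assigned B i) ⊎ k ≤ sum (price B))

    step-progress : ∀ {m} {ρ : Vec Tree m} {g S V} → lookup ρ g ≡ encodeGraph G →
                    lookup ρ V ≡ encodeList encodeVertex (vertices n) →
                    ∀ {k} → Progress k (lookup ρ S) → Progress (suc k) (⟦ step g S V ⟧ N ρ)
    step-progress {ρ = ρ} {g} {S} {V} g≡ V≡ {k} (B , S≡ , inv , done) with unassigned-spec {ρ = ρ} {B = B} {S = S} S≡ {V} V≡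
    ... | nothing , s , value eq rewrite eq =
      B , S≡ , inv , inj₁ λ i → decidable-stable (assigned? B i) (search-nothing s (∈-vertices i))
    ... | just u  , s , value eq rewrite eq
      with cheapest-spec {ρ = encodeVertex u ∷ (encodeVertex u ∙ nil) ∷ ρ} {S = ↑↑ S} S≡ {g = ↑↑ g} {i = 0F} {u = u} inv g≡ refl
    ...   | nothing , s′ , _ = contradiction (λ j → search-nothing s′ (∈-vertices j)) (¬¬cheapest B u)
    ...   | just j  , s′ , value eq′ rewrite eq′ =
      bid u j B ,
      equation (placeBid-spec {ρ = encodeVertex j ∷ encodeVertex u ∷ (encodeVertex u ∙ nil) ∷ ρ} {B = B}
                 {S = suc (↑↑ S)} {i = 1F} {j = 0F} u j (value S≡) (value refl) (value refl)) ,
      bid-invariant inv (search-just s) (search-just s′) ,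
      [ (λ all → contradiction (all u) (search-just s)) , (λ k≤ → inj₂ (≤-trans (s≤s k≤) (sum-price-bid u j B))) ]′ done

    fold-progress : ∀ {f : Tree → Tree → Tree} (Q : ℕ → Tree → Set) → (∀ k x acc → Q k acc → Q (suc k) (f x acc)) →
                    ∀ {M k z} t → spine t ≤ M → Q k z → Q (spine t + k) (foldTree M f z t)
    fold-progress Q f-Q {zero}  nil     _         q = q
    fold-progress Q f-Q {suc M} nil     _         q = q
    fold-progress Q f-Q {suc M} (x ∙ t) (s≤s t≤M) q = f-Q _ x _ (fold-progress Q f-Q t t≤M q)

    noBids : Bids n
    noBids _ = []

    noBids-invariant : Invariant noBids
    noBids-invariant = record { adjacent = λ () ; unique = λ () ; cheap = λ () ; bounded = λ _ → z≤n }

    opaque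
      unfolding auctionTree

      auctionTree-progress : ∀ {s t u k} → s ≡ encodeGraph G → u ≡ encodeList encodeVertex (vertices n) → spine s ≡ k → k < N →
                             Progress 0 t → Progress ((suc k + 0) * suc k) (auctionTree N s t u)
      auctionTree-progress {s} {t} {u} s≡ u≡ refl k<N =
        -- The outer loop counts in rounds of n + 1 steps, whence the product.
        fold-progress (λ k → Progress (k * spine (nil ∙ s)))
          (λ k x acc → fold-progress Progress
            (λ _ x′ acc′ → step-progress {ρ = x′ ∷ acc′ ∷ x ∷ acc ∷ s ∷ t ∷ u ∷ []} {g = ↑↑ (↑↑ 0F)} {1F} {↑↑ (↑↑ 2F)} s≡ u≡)
            (nil ∙ s) k<N)
          {k = 0} (nil ∙ s) k<N

    finalTree : Tree
    finalTree = auctionTree N (encodeGraph G) (encodeBids noBids) (encodeList encodeVertex (vertices n))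

    finalTree-spec : ∃[ B ] finalTree ≡ encodeBids B × Invariant B × (∀ i → Assigned B i)
    finalTree-spec with auctionTree-progress refl refl (spine-encodeGraph G) (≤-trans (n≤1+n _) n+2≤N)
                          (noBids , refl , noBids-invariant , inj₂ z≤n)
    ... | B , eq , inv , inj₁ all  = B , eq , inv , all
    ... | B , eq , inv , inj₂ many = contradiction (≤-trans many (sum-price-≤ inv)) (<⇒≱ (begin-strict
      n * n                 <⟨ *-mono-< (n<1+n n) (n<1+n n) ⟩
      suc n * suc n         ≡⟨ cong (_* suc n) (+-identityʳ (suc n)) ⟨
      (suc n + 0) * suc n   ∎))
      where open ≤-Reasoning

    finalTree-evaluates : ∀ {m} {ρ : Vec Tree m} {g S V} → lookup ρ g ≡ encodeGraph G → lookup ρ S ≡ encodeBids noBids →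
                       lookup ρ V ≡ encodeList encodeVertex (vertices n) → N , ρ ⊨ auction g S V evaluatesTo finalTree
    finalTree-evaluates {ρ = ρ} {g} {S} {V} g≡ S≡ V≡ =
      value (trans (auction-lookup {N = N} {ρ} {g} {S} {V}) (go g≡ S≡ V≡))
      where
      go : ∀ {s t u} → s ≡ encodeGraph G → t ≡ encodeBids noBids → u ≡ encodeList encodeVertex (vertices n) →
           auctionTree N s t u ≡ finalTree
      go refl refl refl = refl

    module _ {B : Bids n} (inv : Invariant B) (assigned : ∀ i → Assigned B i) where
      open Matching inv assigned

      candidates : Fin n → List (Fin n)
      candidates v = owner v ∷ object v ∷ vertices n

      module _ {m} {ρ : Vec Tree m} {S V h v : Fin m} {moves : History n} {u : Fin n}
        (S≡ : lookup ρ S ≡ encodeBids B) (V≡ : lookup ρ V ≡ encodeList encodeVertex (vertices n))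
        (h≡ : lookup ρ h ≡ encodeHistory moves) (v≡ : lookup ρ v ≡ encodeVertex u) where

        owner-spec : N , ρ ⊨ hd (tl (hd (find (var S) (equal (hd (var 0F)) (var (↑↑ v)))))) evaluatesTo encodeVertex (owner u)
        owner-spec with find-spec {ρ = ρ} {l = var S} {p = equal (hd (var 0F)) (var (↑↑ v))} (vertices n)
                          (λ k acc → vertex-equal k u (value refl) (value v≡)) (value S≡)
        ... | nothing , s , _ = contradiction refl (search-nothing s (∈-take-vertices u))
        ... | just k , s , value eq with refl ← search-just s =
          value (trans (cong (head ∘ tail ∘ head) eq) (first (B u) (owns-owner u)))
          where
          first : ∀ b {i} → List.head b ≡ just i → head (encodeList encodeVertex b) ≡ encodeVertex i
          first (i ∷ b) refl = refl

        object-spec : N , ρ ⊨ hd (hd (find (var S) (owns (var (↑↑ v)) (var 0F)))) evaluatesTo encodeVertex (object u)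
        object-spec with find-spec {ρ = ρ} {l = var S} {p = owns (var (↑↑ v)) (var 0F)} (vertices n)
                           (λ k acc → owns-spec B u k (value v≡) (value refl)) (value S≡)
        ... | nothing , s , _ = contradiction (owns-object u) (search-nothing s (∈-take-vertices (object u)))
        ... | just k , s , value eq = value (trans (cong (head ∘ head) eq)
                (cong encodeVertex (Invariant.unique inv (search-just s) (owns-object u))))

        respond-spec : ∃[ r ] Search (λ w → ¬ Taken (take N moves) w) (candidates u) r ×
                       N , ρ ⊨ respond S V h v evaluatesTo encodeMaybe encodeVertex r
        respond-spec = subst (λ ws → ∃[ r ] Search _ ws r × N , ρ ⊨ respond S V h v evaluatesTo encodeMaybe encodeVertex r)
          (take-all N (candidates u) (≤-trans (≤-reflexive (cong (2 +_) (length-descending n ≤-refl))) n+2≤N))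
          (find-spec (candidates u) (λ w acc →
            not-spec (test-map (λ { (_ , move∈ , refl) → ∈-map⁺ proj₂ move∈ })
                               (λ w∈ → let move , move∈ , eq = ∈-map⁻ proj₂ w∈ in move , move∈ , sym eq)
              (any-spec moves (λ (p , x) acc′ → vertex-equal x w (value refl) (value refl)) (value h≡))))
            (value (cong₂ _∙_ (equation owner-spec) (cong₂ _∙_ (equation object-spec) V≡))))

-- The strategy, its running time and the theorem

size-spine : ∀ t → 1 + (spine t + spine t) ≤ size t
size-spine nil     = ≤-refl
size-spine (s ∙ t) = s≤s (begin
  suc (spine t) + suc (spine t)   ≡⟨ cong suc (+-suc (spine t) (spine t)) ⟩
  1 + (1 + (spine t + spine t))   ≤⟨ +-mono-≤ (≤-trans (s≤s z≤n) (size-spine s)) (size-spine t) ⟩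
  size s + size t                 ∎)
  where open ≤-Reasoning

module Solution {r n N} (n+2≤N : 2 + n ≤ N) (G : Graph n) (1≤r : 1 ≤ r) (regular : Regular r G) where

  open Specs n+2≤N
  open Auction G 1≤r regular

  finalBids : Bids n
  finalBids = proj₁ (finalTree-spec G 1≤r regular)

  finalTree≡ : finalTree G 1≤r regular ≡ encodeBids finalBids
  finalTree≡ = proj₁ (proj₂ (finalTree-spec G 1≤r regular))

  invariant : Invariant finalBids
  invariant = proj₁ (proj₂ (proj₂ (finalTree-spec G 1≤r regular)))

  assigned : ∀ i → Assigned finalBids i
  assigned = proj₂ (proj₂ (proj₂ (finalTree-spec G 1≤r regular)))

  open Matching invariant assigned public

  factor : PerfectFactor[1,2] G
  factor = perfectFactor G object object-injective adj-object

  module _ (v₀ : Fin n) (v₀≡0 : toℕ v₀ ≡ 0) (h : History n) where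

    lastVertex-spec : ∀ h → tail (head (encodeHistory h)) ≡ encodeVertex (lastVertex v₀ h)
    lastVertex-spec []      rewrite v₀≡0 = refl
    lastVertex-spec (_ ∷ _) = refl

    opaque
      unfolding main

      main-spec : ∃[ r ] Search (λ w → ¬ Taken (take N h) w)
                                (candidates G 1≤r regular invariant assigned (lastVertex v₀ h)) r ×
                  N , encodeInput G h ∷ [] ⊨ main evaluatesTo head (encodeMaybe encodeVertex r)
      main-spec with respond-spec G 1≤r regular invariant assigned
        {ρ = encodeVertex (lastVertex v₀ h) ∷ encodeHistory h ∷ encodeBids finalBids ∷
             encodeBids (noBids G 1≤r regular) ∷ encodeList encodeVertex (vertices n) ∷ encodeGraph G ∷ encodeInput G h ∷ []}
        {2F} {4F} {1F} {0F} {h} refl refl refl refl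
      ... | r , search , evaluates = r , search ,
        let-spec (value refl)
          (let-spec (vertexList-spec {g = var 0F} (value refl) (spine-encodeGraph G))
            (let-spec (map-spec (vertices n) vertices≤N (λ _ _ → value refl) (value refl))
              (let-spec (subst (λ t → N , _ ⊨ _ evaluatesTo t) finalTree≡
                          (finalTree-evaluates G 1≤r regular refl refl refl))
                (let-spec (value refl)
                  (let-spec (value (lastVertex-spec h)) (hd-spec evaluates))))))

-- One strategy wins whoever starts. The clock is left open: 2 + n serves for the outcome, the
-- length found in the encoded graph for the program.
strategy : ∀ {r n N} → 2 + n ≤ N → (G : Graph n) → 1 ≤ r → Regular r G →
           Σ[ σ ∈ Strategy n ] (∀ first → Wins G σ first []) ×
             (∀ h v → σ h ≡ just v → ⟦ main ⟧ N (encodeInput G h ∷ []) ≡ encodeVertex v)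
strategy {n = zero}  _ G 1≤r regular = (λ _ → nothing) , (λ _ → dominated λ ()) , λ h ()
strategy {n = suc n} {N} n+2≤N G 1≤r regular = σ , wins , computes
  where
  open Solution n+2≤N G 1≤r regular
  σ : Strategy (suc n)
  σ h = proj₁ (main-spec zero refl h)
  wins : ∀ first → Wins G σ first []
  wins = Pairing.σ-wins G owner object owner-object adj-owner adj-object zero (vertices (suc n)) ∈-vertices
    N (≤-trans (m≤n+m _ 2) n+2≤N) σ (λ h → proj₁ (proj₂ (main-spec zero refl h)))
  computes : ∀ h v → σ h ≡ just v → ⟦ main ⟧ N (encodeInput G h ∷ []) ≡ encodeVertex v
  computes h v eq = trans (equation (proj₂ (proj₂ (main-spec zero refl h))))
                          (cong (λ r → head (encodeMaybe encodeVertex r)) eq)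

input-size : ∀ {n} (G : Graph n) h → 3 + spine (encodeGraph G) ≤ size (encodeInput G h)
input-size G h = s≤s (begin
  2 + s                   ≡⟨ +-comm 1 (1 + s) ⟩
  1 + s + 1               ≤⟨ +-mono-≤ (s≤s (m≤m+n s s)) (s≤s z≤n) ⟩
  1 + (s + s) + 1         ≤⟨ +-mono-≤ (size-spine (encodeGraph G)) (≤-trans (s≤s z≤n) (size-spine (encodeHistory h))) ⟩
  size (encodeGraph G) + size (encodeHistory h) ∎)
  where
  open ≤-Reasoning
  s = spine (encodeGraph G)

2+n≤clock : ∀ {n} (G : Graph n) → 2 + n ≤ 2 + spine (encodeGraph G)
2+n≤clock G = ≤-reflexive (cong (2 +_) (sym (spine-encodeGraph G)))

program-yields : ∀ c g h {t} → ⟦ c ⟧ (2 + spine g) ((g ∙ h) ∷ []) ≡ t →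
                 Run program c On g ∙ h Yields t Within (10 + cost c (2 + spine g))
program-yields c g h refl = program-runs c g h

run-within : ∀ {k} {P : Program k} {s t b b′} → Run P On s Yields t Within b → b ≤ b′ → Run P On s Yields t Within b′
run-within (c , run , c≤b) b≤b′ = c , run , ≤-trans c≤b b≤b′

corollary3p5 : (∀ (r n : ℕ) (G : Graph n) → 1 ≤ r → Regular r G →
    PerfectFactor[1,2] G × Outcome𝒟 G)
    × WinningStrategyInPolynomialTime (λ G → ∃[ r ] (1 ≤ r × Regular r G))
corollary3p5 = factor-and-outcome , folds main , program main , 10 + a , d , polynomial
  where
  a = proj₁ (cost-poly main)
  d = proj₁ (proj₂ (cost-poly main))

  factor-and-outcome : ∀ r n (G : Graph n) → 1 ≤ r → Regular r G → PerfectFactor[1,2] G × Outcome𝒟 G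
  factor-and-outcome r n G 1≤r regular = Solution.factor ≤-refl G 1≤r regular ,
    λ first → let σ , wins , _ = strategy ≤-refl G 1≤r regular in σ , wins first

  cost-bound : ∀ N s → suc N ≤ s → 10 + cost main N ≤ (10 + a) * s ^ d + (10 + a)
  cost-bound N s N<s = begin
    10 + cost main N              ≤⟨ +-monoʳ-≤ 10 (proj₂ (proj₂ (cost-poly main)) N) ⟩
    10 + a * suc N ^ d            ≤⟨ +-mono-≤ (m≤m+n 10 a) (*-monoʳ-≤ a (^-monoˡ-≤ d N<s)) ⟩
    (10 + a) + a * s ^ d          ≤⟨ +-monoʳ-≤ (10 + a) (*-monoˡ-≤ (s ^ d) (m≤n+m a 10)) ⟩
    (10 + a) + (10 + a) * s ^ d   ≡⟨ +-comm (10 + a) _ ⟩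
    (10 + a) * s ^ d + (10 + a)   ∎
    where open ≤-Reasoning

  polynomial : ∀ {n} (G : Graph n) → ∃[ r ] (1 ≤ r × Regular r G) →
    Σ[ σ ∈ Strategy n ] Wins G σ staller [] ×
      (∀ h v → σ h ≡ just v →
        Run program main On encodeInput G h Yields encodeVertex v
          Within ((10 + a) * size (encodeInput G h) ^ d + (10 + a)))
  polynomial G (r , 1≤r , regular) = let σ , wins , computes = strategy (2+n≤clock G) G 1≤r regular in
    σ , wins staller , λ h v eq →
      run-within (program-yields main (encodeGraph G) (encodeHistory h) (computes h v eq))
        (cost-bound _ _ (input-size G h))
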